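{- For every integer $k\geq 1$ there are constants $K,\epsilon^*>0$ such that the following holds. Suppose $0<\epsilon<\epsilon^*$ and $H$ is a sufficiently large $3$-uniform hypergraph (that is, the number of vertices of $H$ is at least some $n_0=n_0(k,\epsilon)$) with slicewise VC-dimension less than $k$. Then there exists an $\epsilon$-homogeneous partition for $H$ of size (number of parts) at most $2^{2^{\epsilon^{ -K}}}$.
   Context: All hypergraphs are finite. A $3$-uniform hypergraph ($3$-graph) is a pair $H=(V,E)$ with $E\subseteq\binom{V}{3}$. The VC-dimension $\mathrm{VC}(G)$ of a graph $G=(V,E)$ is the largest $m$ for which there exist vertices $\{a_i:i\in[m]\}\cup\{b_S:S\subseteq[m]\}\subseteq V$ such that for all $i\in[m]$, $S\subseteq[m]$: $a_ib_S\in E$ if and only if $i\in S$. For a $3$-graph $H=(V,E)$ and $x\in V$, the slice graph $H_x$ is the graph with vertex set $V$ and edge set $\{yz\in\binom{V}{2}: xyz\in E\}$. The slicewise VC-dimension of $H$ is $\mathrm{SVC}(H)=\max\{\mathrm{VC}(H_x):x\in V\}$. For nonempty $X,Y,Z\subseteq V$ (not necessarily disjoint or distinct), $d_H(X,Y,Z)=|\{(x,y,z)\in X\times Y\times Z:\{x,y,z\}\in E\}|/(|X||Y||Z|)$. The triple $(X,Y,Z)$ is $\epsilon$-homogeneous with respect to $H$ if $d_H(X,Y,Z)\in[0,\epsilon)\cup(1-\epsilon,1]$. A partition $\mathcal{P}$ of $V$ is $\epsilon$-homogeneous with respect to $H$ if for at least $(1-\epsilon)|V|^3$ many $(x,y,z)\in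 V^3$ there is an $\epsilon$-homogeneous triple $(X,Y,Z)\in\mathcal{P}^3$ with $(x,y,z)\in X\times Y\times Z$. -}

module Defs where

import Algebra.Definitions.RawSemiring as RawSemiring
open import Data.Fin.Base using (Fin)
open import Data.Fin.Subset using (Subset; _∈_; _∪_; ⁅_⁆; ∣_∣; Nonempty)
open import Data.Fin.Subset.Properties using (_∈?_; ∣⁅x⁆∣≡1; x∈⁅y⁆⇒x≡y; p⊆q⇒∣p∣≤∣q∣)
open import Data.Integer.Base using (+_)
open import Data.List.Base using (List; length; filter; cartesianProduct; allFin)
open import Data.List.Relation.Unary.All using (All)
open import Data.List.Relation.Unary.Unique.Propositional using (Unique)
open import Data.Nat.Base as ℕ using (ℕ; suc; NonZero; >-nonZero)
import Data.Nat.Properties as ℕ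
open import Data.Product.Base using (_×_; _,_; ∃-syntax; Σ-syntax)
open import Data.Rational.Base using (ℚ; _/_; 0ℚ; 1ℚ; -_; _<_; _≤_; _+_; _-_; _*_; +-*-rawSemiring)
open import Data.Rational.Properties
  using (<-trans; ≤-<-trans; <-irrefl; <-dense; ≮⇒≥; _<?_; +-monoʳ-<; +-identityʳ)
open import Data.Sum.Base using (_⊎_; inj₁; inj₂)
open import Function.Bundles using (_⇔_)
open import Relation.Binary.PropositionalEquality using (_≡_; refl; sym; subst)
open import Relation.Nullary using (¬_; yes; no)
open import Relation.Nullary.Decidable using (_×-dec_; from-yes)
open import Relation.Unary using (Pred; Decidable)
open import Level using (0ℓ)

open RawSemiring +-*-rawSemiring using () renaming (_^_ to _^ℚ_)

fromℕ : ℕ → ℚ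
fromℕ n = + n / 1

-- Two-sided Dedekind cuts: `Below q` means q < x and `Above q` means x < q.
record ℝ : Set₁ where
  field
    Below Above     : Pred ℚ 0ℓ
    below-inhabited : ∃[ q ] Below q
    above-inhabited : ∃[ q ] Above q
    below-closed    : ∀ {p q} → p < q → Below q → Below p
    above-closed    : ∀ {p q} → p < q → Above p → Above q
    below-open      : ∀ {p} → Below p → ∃[ q ] p < q × Below q
    above-open      : ∀ {q} → Above q → ∃[ p ] p < q × Above p
    disjoint        : ∀ {q} → ¬ (Below q × Above q)
    located         : ∀ {p q} → p < q → Below p ⊎ Above q

open ℝ

infix 4 _<ᵣ_
_<ᵣ_ : ℝ → ℝ → Set
x <ᵣ y = ∃[ q ] Above x q × Below y q

fromℚ : ℚ → ℝ
fromℚ x = record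
  { Below           = _< x
  ; Above           = x <_
  ; below-inhabited = x - 1ℚ , subst (x - 1ℚ <_) (+-identityʳ x) (+-monoʳ-< x (from-yes (- 1ℚ <? 0ℚ)))
  ; above-inhabited = x + 1ℚ , subst (_< x + 1ℚ) (+-identityʳ x) (+-monoʳ-< x (from-yes (0ℚ <? 1ℚ)))
  ; below-closed    = <-trans
  ; above-closed    = λ p<q x<p → <-trans x<p p<q
  ; below-open      = <-dense
  ; above-open      = λ x<q → let m , x<m , m<q = <-dense x<q in m , m<q , x<m
  ; disjoint        = λ (q<x , x<q) → <-irrefl refl (<-trans q<x x<q)
  ; located         = locate
  }
  where
  locate : ∀ {p q} → p < q → p < x ⊎ x < q
  locate {p} p<q with p <? x
  ... | yes p<x = inj₁ p<x
  ... | no  p≮x = inj₂ (≤-<-trans (≮⇒≥ p≮x) p<q)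

0ᵣ : ℝ
0ᵣ = fromℚ 0ℚ

-- A real used only as an upper bound for naturals is given by the set of
-- rationals strictly greater than it.
UpperCut : Set₁
UpperCut = Pred ℚ 0ℓ

-- x ^ (- K) for x > 0: q > x ^ (- K) iff q > r ^ (- K), i.e. 1 < q * r ^ K,
-- for some rational r with 0 < r < x.
infixr 8 _^-_
_^-_ : ℝ → ℕ → UpperCut
(x ^- K) q = ∃[ r ] 0ℚ < r × Below x r × 1ℚ < q * r ^ℚ K

-- 2 ^ y for y ≥ 0: q > 2 ^ y iff q > 2 ^ (a / b), i.e. q > 0 and 2 ^ a < q ^ b,
-- for some fraction a / b > y (with b = suc b-1).
infixr 8 2^_
2^_ : UpperCut → UpperCut
(2^ Y) q = ∃[ a ] ∃[ b-1 ] Y (+ a / suc b-1) × 0ℚ < q × fromℕ (2 ℕ.^ a) < q ^ℚ suc b-1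

infix 4 _≤ᵘ_
_≤ᵘ_ : ℕ → UpperCut → Set
N ≤ᵘ Y = ∀ q → Y q → fromℕ N ≤ q

record UniformHypergraph (r n : ℕ) : Set₁ where
  field
    Edge    : Pred (Subset n) 0ℓ
    edge?   : Decidable Edge
    uniform : ∀ {e} → Edge e → ∣ e ∣ ≡ r

open UniformHypergraph

Graph 3-Graph : ℕ → Set₁
Graph   = UniformHypergraph 2
3-Graph = UniformHypergraph 3

Greatest : Pred ℕ 0ℓ → Pred ℕ 0ℓ
Greatest P m = P m × (∀ {l} → P l → l ℕ.≤ m)

Shatters : ∀ {n} → Graph n → ℕ → Set
Shatters {n} G m = Σ[ a ∈ (Fin m → Fin n) ] Σ[ b ∈ (Subset m → Fin n) ]
  ∀ (i : Fin m) (S : Subset m) → Edge G (⁅ a i ⁆ ∪ ⁅ b S ⁆) ⇔ i ∈ S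

-- As a relation: `VC G m` says that the VC-dimension of G is m.
VC : ∀ {n} → Graph n → ℕ → Set
VC G = Greatest (Shatters G)

slice : ∀ {n} → 3-Graph n → Fin n → Graph n
slice H x = record
  { Edge    = λ e → ∣ e ∣ ≡ 2 × Edge H (⁅ x ⁆ ∪ e)
  ; edge?   = λ e → (∣ e ∣ ℕ.≟ 2) ×-dec edge? H (⁅ x ⁆ ∪ e)
  ; uniform = λ (∣e∣≡2 , _) → ∣e∣≡2
  }

SVC : ∀ {n} → 3-Graph n → ℕ → Set
SVC H = Greatest (λ m → ∃[ x ] VC (slice H x) m)

Triple : ℕ → Set
Triple n = Fin n × Fin n × Fin n

InBox : ∀ {n} → (X Y Z : Subset n) → Pred (Triple n) 0ℓ
InBox X Y Z (x , y , z) = x ∈ X × y ∈ Y × z ∈ Z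

EdgeTriple : ∀ {n} → 3-Graph n → Pred (Triple n) 0ℓ
EdgeTriple H (x , y , z) = Edge H (⁅ x ⁆ ∪ ⁅ y ⁆ ∪ ⁅ z ⁆)

#edges : ∀ {n} → 3-Graph n → (X Y Z : Subset n) → ℕ
#edges {n} H X Y Z = length (filter counted? allTriples)
  where
  allTriples : List (Triple n)
  allTriples = cartesianProduct (allFin n) (cartesianProduct (allFin n) (allFin n))
  counted? : Decidable (λ t → InBox X Y Z t × EdgeTriple H t)
  counted? (x , y , z) =
    (x ∈? X ×-dec y ∈? Y ×-dec z ∈? Z) ×-dec edge? H (⁅ x ⁆ ∪ ⁅ y ⁆ ∪ ⁅ z ⁆)

∣∣-nonZero : ∀ {n} {X : Subset n} → Nonempty X → NonZero ∣ X ∣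
∣∣-nonZero {X = X} (x , x∈X) = >-nonZero (subst (ℕ._≤ ∣ X ∣) (∣⁅x⁆∣≡1 x)
  (p⊆q⇒∣p∣≤∣q∣ λ y∈⁅x⁆ → subst (_∈ X) (sym (x∈⁅y⁆⇒x≡y x y∈⁅x⁆)) x∈X))

density : ∀ {n} → 3-Graph n → {X Y Z : Subset n} →
          Nonempty X → Nonempty Y → Nonempty Z → ℚ
density H {X} {Y} {Z} neX neY neZ = + #edges H X Y Z / (∣ X ∣ ℕ.* ∣ Y ∣ ℕ.* ∣ Z ∣)
  where instance
    _ = ∣∣-nonZero neX
    _ = ∣∣-nonZero neY
    _ = ∣∣-nonZero neZ
    _ = ℕ.m*n≢0 ∣ X ∣ ∣ Y ∣
    _ = ℕ.m*n≢0 (∣ X ∣ ℕ.* ∣ Y ∣) ∣ Z ∣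

-- The density d always lies in [0, 1], so membership in [0, ε) ∪ (1 - ε, 1]
-- amounts to d < ε or 1 - d < ε.
HomogeneousTriple : ∀ {n} → ℝ → 3-Graph n → {X Y Z : Subset n} →
                    Nonempty X → Nonempty Y → Nonempty Z → Set
HomogeneousTriple ε H neX neY neZ = Below ε d ⊎ Below ε (1ℚ - d)
  where d = density H neX neY neZ

record Partition (n N : ℕ) : Set where
  field
    part     : Fin N → Subset n
    nonempty : ∀ i → Nonempty (part i)
    cover    : ∀ v → ∃[ i ] v ∈ part i
    disjoint : ∀ {v i j} → v ∈ part i → v ∈ part j → i ≡ j

open Partition using (part; nonempty)

-- Comparison with a real ε is not decidable, so "at least (1 - ε) n³ triples"
-- is expressed by a duplicate-free list T of such triples; the inequality
-- (1 - ε) n³ ≤ length T is tested on all rationals q > ε.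
HomogeneousPartition : ∀ {n N} → ℝ → 3-Graph n → Partition n N → Set
HomogeneousPartition {n} ε H P =
  ∃[ T ] Unique T × All Good T ×
         (∀ q → Above ε q → (1ℚ - q) * fromℕ (n ℕ.^ 3) ≤ fromℕ (length T))
  where
  Good : Pred (Triple n) 0ℓ
  Good t = ∃[ i ] ∃[ j ] ∃[ l ]
    HomogeneousTriple ε H (nonempty P i) (nonempty P j) (nonempty P l) ×
    InBox (part P i) (part P j) (part P l) t

{-# OPTIONS --safe #-}

-- Let n be the number of vertices and f x y z the indicator of the edges.  It
-- suffices to label the vertices with few labels so that, on average over
-- (y, z), f x y z is predicted up to a small error by y, z and the label of x.
-- By symmetry the same then holds with y or z in the role of x, hence f is
-- nearly constant on most boxes formed by the label classes, and a box with
-- few exceptions to a constant is homogeneous.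
--
-- For a bipartite graph in which the rows do not shatter k columns, Haussler's
-- one-inclusion argument gives the prediction: the sum over the edges of the
-- cube {0,1}^s of the minimum of the two end weights is at most k times the
-- total weight, for every weight whose support shatters no k coordinates.
-- Taking as weight the number of rows with a given trace on s random columns,
-- exchangeability shows that the trace on s - 1 random columns predicts the
-- entry at one more random column with error at most k / s on average.
--
-- Choose r vertices z₁, …, z_r such that, for most y, the bits f x y zᵢ predict
-- f x y z, and for each zᵢ choose s vertices yᵢⱼ such that the bits f x yᵢⱼ zᵢ
-- predict f x y zᵢ.  The bits f x yᵢⱼ zᵢ form the label of x.  With r polynomial
-- in 1 / ε and s about r², there are at most 2 ^ (r * s) labels.

module Submission where

open import Defs
open import Algebra.Bundles using (CommutativeMonoid)
import Algebra.Definitions.RawSemiring as RawSemiring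
open import Data.Bool.Base using (Bool; true; false; _xor_; _∧_)
import Data.Bool.Properties as Bool
open import Data.Empty using (⊥; ⊥-elim)
open import Data.Fin as Fin using (Fin; zero; suc; punchIn; punchOut; funToFin; finToFun)
import Data.Fin.Properties as Fin
open import Data.Fin.Subset using (Subset; ⁅_⁆; _∪_; ∣_∣) renaming (_∈_ to _∈ˢ_)
open import Data.Fin.Subset.Properties using (∪-comm; ∪-assoc; ∣⁅x⁆∣≡1; x∈⁅x⁆; x∈⁅y⁆⇒x≡y; _∈?_)
open import Data.List.Base using (List; []; _∷_; _++_; length; map; filter; tabulate; allFin; cartesianProduct)
open import Data.List.Membership.Propositional using (_∈_)
open import Data.List.Membership.Propositional.Properties using (∈-filter⁺; ∈-filter⁻; ∈-allFin; ∈-length)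
open import Data.List.Properties using (length-tabulate; map-tabulate)
open import Data.List.Relation.Unary.All as All using ()
open import Data.List.Relation.Unary.All.Properties using (all-filter)
open import Data.List.Relation.Unary.Any using (here)
import Data.List.Relation.Unary.Unique.Propositional.Properties as Unique
import Data.Nat.Base as ℕ
import Data.Nat.Properties as ℕ
open import Data.Nat.Tactic.RingSolver using (solve-∀)
open import Data.Product.Base using (Σ; Σ-syntax; ∃-syntax; _×_; _,_; proj₁; proj₂)
open import Data.Rational.Base as ℚ using (ℚ; 0ℚ; 1ℚ)
import Data.Rational.Properties as ℚ
open import Data.Sum.Base using (_⊎_; inj₁; inj₂)
open import Data.Unit.Base using (⊤; tt)
open import Data.Vec.Base as Vec using (Vec; []; _∷_; lookup)
open import Data.Vec.Properties
  using (lookup-map; lookup⇒[]=; []=⇒lookup; lookup∘tabulate; tabulate∘lookup; tabulate-cong; length-toList)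
open import Function.Base using (_∘_; const; id)
open import Function.Bundles using (Equivalence; Inverse; mk⇔)
open import Level using (0ℓ)
open import Relation.Binary.PropositionalEquality
open import Relation.Nullary using (¬_; Dec; does; yes; no)
open import Relation.Nullary.Decidable using (dec-true; does-⇔; from-yes)
open import Relation.Unary using (Decidable; Pred)

open Equivalence using (to; from)
open UniformHypergraph
open ℝ using (Below; Above; above-closed; below-closed; disjoint; located)

-- Fractions and cuts

module Rationals where
  open import Data.Integer.Base as ℤ using (+_; +<+; +[1+_])
  import Data.Integer.Properties as ℤ
  import Data.Rational.Unnormalised.Base as ℚᵘ
  import Data.Rational.Unnormalised.Properties as ℚᵘ
  open import Data.Nat.Base using (ℕ; zero; suc; s≤s; z≤n; NonZero)
  open import Data.Rational.Base hiding (NonZero)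
  open import Data.Rational.Properties
  open RawSemiring +-*-rawSemiring using () renaming (_^_ to _^ℚ_)

  toℚᵘ-/ : ∀ a b → toℚᵘ (+ a / suc b) ℚᵘ.≃ ℚᵘ.mkℚᵘ (+ a) b
  toℚᵘ-/ a b = toℚᵘ-fromℚᵘ (ℚᵘ.mkℚᵘ (+ a) b)

  /-mono : ∀ a b c d .{{_ : NonZero b}} .{{_ : NonZero d}} → a ℕ.* d ℕ.≤ c ℕ.* b → + a / b ≤ + c / d
  /-mono a (suc b) c (suc d) le = toℚᵘ-cancel-≤ (ℚᵘ.≤-respˡ-≃ (ℚᵘ.≃-sym (toℚᵘ-/ a b))
    (ℚᵘ.≤-respʳ-≃ (ℚᵘ.≃-sym (toℚᵘ-/ c d))
      (ℚᵘ.*≤* (subst₂ ℤ._≤_ (ℤ.pos-* a (suc d)) (ℤ.pos-* c (suc b)) (ℤ.+≤+ le)))))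

  /-cancel : ∀ a b c d .{{_ : NonZero b}} .{{_ : NonZero d}} → + a / b ≤ + c / d → a ℕ.* d ℕ.≤ c ℕ.* b
  /-cancel a (suc b) c (suc d) le
    with ℚᵘ.*≤* le′ ← ℚᵘ.≤-respˡ-≃ (toℚᵘ-/ a b) (ℚᵘ.≤-respʳ-≃ (toℚᵘ-/ c d) (toℚᵘ-mono-≤ le)) =
    ℤ.drop‿+≤+ (subst₂ ℤ._≤_ (sym (ℤ.pos-* a (suc d))) (sym (ℤ.pos-* c (suc b))) le′)

  /-* : ∀ a b c d .{{_ : NonZero b}} .{{_ : NonZero d}} .{{_ : NonZero (b ℕ.* d)}} →
        (+ a / b) * (+ c / d) ≡ + (a ℕ.* c) / (b ℕ.* d)
  /-* a b@(suc b′) c d@(suc d′) = toℚᵘ-injective (begin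
    toℚᵘ ((+ a / b) * (+ c / d))                        ≈⟨ toℚᵘ-homo-* (+ a / b) (+ c / d) ⟩
    toℚᵘ (+ a / b) ℚᵘ.* toℚᵘ (+ c / d)                  ≈⟨ ℚᵘ.*-cong (toℚᵘ-/ a b′) (toℚᵘ-/ c d′) ⟩
    ℚᵘ.mkℚᵘ (+ a) b′ ℚᵘ.* ℚᵘ.mkℚᵘ (+ c) d′              ≡⟨ cong (λ i → ℚᵘ.mkℚᵘ i (d′ ℕ.+ b′ ℕ.* d)) (ℤ.pos-* a c) ⟨
    ℚᵘ.mkℚᵘ (+ (a ℕ.* c)) (d′ ℕ.+ b′ ℕ.* d)             ≈⟨ toℚᵘ-/ (a ℕ.* c) (d′ ℕ.+ b′ ℕ.* d) ⟨
    toℚᵘ (+ (a ℕ.* c) / (b ℕ.* d))                      ∎)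
    where open ℚᵘ.≃-Reasoning

  /-+ : ∀ a b c d .{{_ : NonZero b}} .{{_ : NonZero d}} .{{_ : NonZero (b ℕ.* d)}} →
        (+ a / b) + (+ c / d) ≡ + (a ℕ.* d ℕ.+ c ℕ.* b) / (b ℕ.* d)
  /-+ a b@(suc b′) c d@(suc d′) = toℚᵘ-injective (begin
    toℚᵘ ((+ a / b) + (+ c / d))                        ≈⟨ toℚᵘ-homo-+ (+ a / b) (+ c / d) ⟩
    toℚᵘ (+ a / b) ℚᵘ.+ toℚᵘ (+ c / d)                  ≈⟨ ℚᵘ.+-cong (toℚᵘ-/ a b′) (toℚᵘ-/ c d′) ⟩
    ℚᵘ.mkℚᵘ (+ a) b′ ℚᵘ.+ ℚᵘ.mkℚᵘ (+ c) d′              ≡⟨ cong (λ i → ℚᵘ.mkℚᵘ i (d′ ℕ.+ b′ ℕ.* d)) (cong₂ ℤ._+_ (ℤ.pos-* a d) (ℤ.pos-* c b)) ⟨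
    ℚᵘ.mkℚᵘ (+ (a ℕ.* d ℕ.+ c ℕ.* b)) (d′ ℕ.+ b′ ℕ.* d) ≈⟨ toℚᵘ-/ (a ℕ.* d ℕ.+ c ℕ.* b) (d′ ℕ.+ b′ ℕ.* d) ⟨
    toℚᵘ (+ (a ℕ.* d ℕ.+ c ℕ.* b) / (b ℕ.* d))          ∎)
    where open ℚᵘ.≃-Reasoning

  fromℕ-* : ∀ a b → fromℕ (a ℕ.* b) ≡ fromℕ a * fromℕ b
  fromℕ-* a b = sym (/-* a 1 b 1)

  fromℕ-+ : ∀ a b → fromℕ (a ℕ.+ b) ≡ fromℕ a + fromℕ b
  fromℕ-+ a b = sym (trans (/-+ a 1 b 1) (cong fromℕ (cong₂ ℕ._+_ (ℕ.*-identityʳ a) (ℕ.*-identityʳ b))))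

  fromℕ-mono : ∀ {a b} → a ℕ.≤ b → fromℕ a ≤ fromℕ b
  fromℕ-mono {a} {b} a≤b = /-mono a 1 b 1 (ℕ.*-monoˡ-≤ 1 a≤b)

  fromℕ-^ : ∀ a b → fromℕ (a ℕ.^ b) ≡ fromℕ a ^ℚ b
  fromℕ-^ a zero    = refl
  fromℕ-^ a (suc b) = trans (fromℕ-* a (a ℕ.^ b)) (cong (fromℕ a *_) (fromℕ-^ a b))

  ^ℚ-nonNeg : ∀ {p} b → 0ℚ ≤ p → 0ℚ ≤ p ^ℚ b
  ^ℚ-nonNeg zero    0≤p = *≤* (ℤ.+≤+ z≤n)
  ^ℚ-nonNeg {p} (suc b) 0≤p = subst (_≤ p * p ^ℚ b) (*-zeroʳ p)
    (*-monoˡ-≤-nonNeg p {{nonNegative 0≤p}} (^ℚ-nonNeg b 0≤p))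

  ^ℚ-mono : ∀ {p q} b → 0ℚ ≤ p → p ≤ q → p ^ℚ b ≤ q ^ℚ b
  ^ℚ-mono zero    0≤p p≤q = ≤-refl
  ^ℚ-mono {p} {q} (suc b) 0≤p p≤q = ≤-trans
    (*-monoˡ-≤-nonNeg p {{nonNegative 0≤p}} (^ℚ-mono b 0≤p p≤q))
    (*-monoʳ-≤-nonNeg (q ^ℚ b) {{nonNegative (^ℚ-nonNeg b (≤-trans 0≤p p≤q))}} p≤q)

  1^ℚ : ∀ b → 1ℚ ^ℚ b ≡ 1ℚ
  1^ℚ zero    = refl
  1^ℚ (suc b) = trans (*-identityˡ (1ℚ ^ℚ b)) (1^ℚ b)

  *-^ℚ : ∀ p q b → (p * q) ^ℚ b ≡ p ^ℚ b * q ^ℚ b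
  *-^ℚ p q zero    = refl
  *-^ℚ p q (suc b) = trans (cong (p * q *_) (*-^ℚ p q b)) (interchange p q (p ^ℚ b) (q ^ℚ b))
    where
    open import Algebra.Properties.CommutativeSemigroup (CommutativeMonoid.commutativeSemigroup *-1-commutativeMonoid)
      using (interchange)

  0≤fromℕ : ∀ a → 0ℚ ≤ fromℕ a
  0≤fromℕ a = fromℕ-mono {0} {a} z≤n

  -- The witness `a / suc b-1` lies above the cut `Y`, so `c * suc b-1 ≤ a`. If `q` were smaller
  -- than 2 ^ c, its power with exponent `suc b-1` would be at most 2 ^ a, against the witness.
  2^-lower : ∀ {Y} c → (∀ q → Y q → fromℕ c ≤ q) → ∀ q → (2^ Y) q → fromℕ (2 ℕ.^ c) ≤ q
  2^-lower {Y} c c≤Y q (a , b-1 , Ya/b , 0<q , 2ᵃ<qᵇ) = ≮⇒≥ λ q<2ᶜ → <-irrefl refl (begin-strict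
    fromℕ (2 ℕ.^ a)             <⟨ 2ᵃ<qᵇ ⟩
    q ^ℚ suc b-1                ≤⟨ ^ℚ-mono (suc b-1) (<⇒≤ 0<q) (<⇒≤ q<2ᶜ) ⟩
    fromℕ (2 ℕ.^ c) ^ℚ suc b-1  ≡⟨ fromℕ-^ (2 ℕ.^ c) (suc b-1) ⟨
    fromℕ ((2 ℕ.^ c) ℕ.^ suc b-1) ≡⟨ cong fromℕ (ℕ.^-*-assoc 2 c (suc b-1)) ⟩
    fromℕ (2 ℕ.^ (c ℕ.* suc b-1)) ≤⟨ fromℕ-mono (ℕ.^-monoʳ-≤ 2 c*b≤a) ⟩
    fromℕ (2 ℕ.^ a)             ∎)
    where
    open ≤-Reasoning
    c*b≤a : c ℕ.* suc b-1 ℕ.≤ a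
    c*b≤a = subst (c ℕ.* suc b-1 ℕ.≤_) (ℕ.*-identityʳ a) (/-cancel c 1 a (suc b-1) (c≤Y _ Ya/b))

  ≤∧≢⇒< : ∀ {p q} → p ≤ q → p ≢ q → p < q
  ≤∧≢⇒< p≤q p≢q = ≰⇒> λ q≤p → p≢q (≤-antisym p≤q q≤p)

  below<above : ∀ (x : ℝ) {p q} → Below x p → Above x q → p < q
  below<above x {p} {q} p<x x<q with p <? q
  ... | yes p<q = p<q
  ... | no  p≮q with q ≟ p
  ...   | yes refl = ⊥-elim (disjoint x (p<x , x<q))
  ...   | no  q≢p  = ⊥-elim (disjoint x (p<x , above-closed x (≤∧≢⇒< (≮⇒≥ p≮q) q≢p) x<q))

  below-≤ : ∀ (x : ℝ) {p q} → p ≤ q → Below x q → Below x p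
  below-≤ x {p} {q} p≤q q<x with p ≟ q
  ... | yes refl = q<x
  ... | no  p≢q  = below-closed x (≤∧≢⇒< p≤q p≢q) q<x

  unit : ∀ t → .{{NonZero t}} → ℚ
  unit t = + 1 / t

  unit-* : ∀ t .{{_ : NonZero t}} → unit t * fromℕ t ≡ 1ℚ
  unit-* t@(suc _) = trans (/-* 1 t t 1) (≤-antisym
    (/-mono (1 ℕ.* t) (t ℕ.* 1) 1 1 (ℕ.≤-reflexive (lemma t)))
    (/-mono 1 1 (1 ℕ.* t) (t ℕ.* 1) (ℕ.≤-reflexive (sym (lemma t)))))
    where
    lemma : ∀ t → 1 ℕ.* t ℕ.* 1 ≡ 1 ℕ.* (t ℕ.* 1)
    lemma = solve-∀

  -- The `r` in a witness for `q` is below `x`, hence below 1 / t, so 1 < q * r ^ K can hold only if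
  -- `q` is at least t ^ K.
  ^--lower : ∀ x t K .{{_ : NonZero t}} → Above x (unit t) → ∀ q → (x ^- K) q → fromℕ (t ℕ.^ K) ≤ q
  ^--lower x t K x<1/t q (r , 0<r , r<x , 1<qrᴷ) = ≮⇒≥ λ q<tᴷ → <-irrefl refl (begin-strict
    1ℚ                             <⟨ 1<qrᴷ ⟩
    q * r ^ℚ K                     ≤⟨ *-monoʳ-≤-nonNeg (r ^ℚ K) {{nonNegative (^ℚ-nonNeg K (<⇒≤ 0<r))}} (<⇒≤ q<tᴷ) ⟩
    fromℕ (t ℕ.^ K) * r ^ℚ K       ≡⟨ *-comm (fromℕ (t ℕ.^ K)) (r ^ℚ K) ⟩
    r ^ℚ K * fromℕ (t ℕ.^ K)       ≤⟨ *-monoʳ-≤-nonNeg (fromℕ (t ℕ.^ K)) {{nonNegative (0≤fromℕ (t ℕ.^ K))}}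
                                        (^ℚ-mono K (<⇒≤ 0<r) (<⇒≤ (below<above x r<x x<1/t))) ⟩
    unit t ^ℚ K * fromℕ (t ℕ.^ K)  ≡⟨ cong (unit t ^ℚ K *_) (fromℕ-^ t K) ⟩
    unit t ^ℚ K * fromℕ t ^ℚ K     ≡⟨ *-^ℚ (unit t) (fromℕ t) K ⟨
    (unit t * fromℕ t) ^ℚ K        ≡⟨ cong (_^ℚ K) (unit-* t) ⟩
    1ℚ ^ℚ K                        ≡⟨ 1^ℚ K ⟩
    1ℚ                             ∎)
    where open ≤-Reasoning

  n<2^n : ∀ n → n ℕ.< 2 ℕ.^ n
  n<2^n zero    = s≤s z≤n
  n<2^n (suc n) = ℕ.≤-trans (ℕ.+-mono-≤ (ℕ.m^n>0 2 n) (n<2^n n))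
    (ℕ.≤-reflexive (cong (2 ℕ.^ n ℕ.+_) (sym (ℕ.+-identityʳ (2 ℕ.^ n)))))

  unit-< : ∀ t .{{_ : NonZero t}} → unit (suc t) < unit t
  unit-< t = ≰⇒> λ le → ℕ.<⇒≱ (ℕ.n<1+n (1 ℕ.* t))
    (ℕ.≤-trans (ℕ.≤-reflexive (lemma t)) (/-cancel 1 t 1 (suc t) le))
    where
    lemma : ∀ t → suc (1 ℕ.* t) ≡ 1 ℕ.* suc t
    lemma = solve-∀

  -- Comparing `ε` with a single fraction is undecidable, but locatedness decides between two
  -- distinct ones. This is why the two denominators differ by 2 and not by 1.
  bracket : ∀ ε → 0ᵣ <ᵣ ε → ε <ᵣ fromℚ (unit 4) → ∃[ j ] Below ε (unit (5 ℕ.+ j)) × Above ε (unit (3 ℕ.+ j))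
  bracket ε (mkℚ (ℤ.+ zero) _ _ , *<* (+<+ ()) , _)
  bracket ε (mkℚ ℤ.-[1+ _ ] _ _ , *<* () , _)
  -- A positive fraction with denominator `suc d-1` is at least 1 / (4 + d-1), so the search can
  -- start there. It lowers the denominator and must stop before 1 / 4, which is above `ε`.
  bracket ε (p@(mkℚ +[1+ a ] d-1 _) , _ , p<ε) (q , ε<q , q<1/4) = search d-1 (below-≤ ε
    (subst (unit (4 ℕ.+ d-1) ≤_) (↥p/↧p≡p p) (/-mono 1 (4 ℕ.+ d-1) (suc a) (suc d-1)
      (ℕ.*-mono-≤ (s≤s (z≤n {a})) (s≤s (ℕ.m≤n+m d-1 3))))) p<ε)
    where
    search : ∀ j → Below ε (unit (4 ℕ.+ j)) → ∃[ j ] Below ε (unit (5 ℕ.+ j)) × Above ε (unit (3 ℕ.+ j))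
    search zero    1/4<ε = ⊥-elim (<-irrefl refl (<-trans q<1/4 (below<above ε 1/4<ε ε<q)))
    search (suc j) b with located ε (unit-< (3 ℕ.+ j))
    ... | inj₁ below = search j below
    ... | inj₂ above = j , b , above

  -- The hypothesis is 1 ≤ 1 / m + e / v cross-multiplied, in the shape that `/-+` and `/-mono`
  -- produce.
  /-complement : ∀ e v m .{{_ : NonZero m}} .{{_ : NonZero v}} →
    1 ℕ.* (m ℕ.* v) ℕ.≤ (1 ℕ.* v ℕ.+ e ℕ.* m) ℕ.* 1 → 1ℚ - + e / v ≤ unit m
  /-complement e v m le = begin
    1ℚ - d            ≤⟨ +-monoˡ-≤ (- d) 1≤ ⟩
    (unit m + d) - d  ≡⟨ +-assoc (unit m) d (- d) ⟩
    unit m + (d - d)  ≡⟨ cong (λ x → unit m + x) (+-inverseʳ d) ⟩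
    unit m + 0ℚ       ≡⟨ +-identityʳ (unit m) ⟩
    unit m            ∎
    where
    open ≤-Reasoning
    d = + e / v
    instance
      m*v≢0 : NonZero (m ℕ.* v)
      m*v≢0 = ℕ.m*n≢0 m v
    1≤ : 1ℚ ≤ unit m + d
    1≤ = subst (1ℚ ≤_) (sym (/-+ 1 m e v)) (/-mono 1 1 (1 ℕ.* v ℕ.+ e ℕ.* m) (m ℕ.* v) le)

  -- Turns a count `b` of bad triples into the rational inequality of `HomogeneousPartition`: at
  -- most the fraction 1 / m of all triples is lost, and 1 / m is at most `q`.
  most-good : ∀ n m g b .{{_ : NonZero m}} → g ℕ.+ b ≡ n ℕ.^ 3 → m ℕ.* b ℕ.≤ n ℕ.^ 3 →
              ∀ q → unit m ≤ q → (1ℚ - q) * fromℕ (n ℕ.^ 3) ≤ fromℕ g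
  most-good n m g b total few q 1/m≤q = begin
    (1ℚ - q) * X         ≤⟨ *-monoʳ-≤-nonNeg X {{nonNegative (0≤fromℕ (n ℕ.^ 3))}} (+-monoʳ-≤ 1ℚ (neg-antimono-≤ 1/m≤q)) ⟩
    (1ℚ - u) * X         ≡⟨ *-distribʳ-+ X 1ℚ (- u) ⟩
    1ℚ * X + - u * X     ≡⟨ cong₂ _+_ (*-identityˡ X) (sym (neg-distribˡ-* u X)) ⟩
    X - u * X            ≤⟨ +-monoʳ-≤ X (neg-antimono-≤ b≤uX) ⟩
    X - fromℕ b          ≡⟨ cong (_- fromℕ b) (trans (cong fromℕ (sym total)) (fromℕ-+ g b)) ⟩
    (fromℕ g + fromℕ b) - fromℕ b ≡⟨ +-assoc (fromℕ g) (fromℕ b) (- fromℕ b) ⟩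
    fromℕ g + (fromℕ b - fromℕ b) ≡⟨ cong (λ x → fromℕ g + x) (+-inverseʳ (fromℕ b)) ⟩
    fromℕ g + 0ℚ         ≡⟨ +-identityʳ (fromℕ g) ⟩
    fromℕ g              ∎
    where
    open ≤-Reasoning
    X u : ℚ
    X = fromℕ (n ℕ.^ 3)
    u = unit m
    0≤u : 0ℚ ≤ u
    0≤u = /-mono 0 1 1 m z≤n
    b≤uX : fromℕ b ≤ u * X
    b≤uX = begin
      fromℕ b                    ≡⟨ *-identityˡ (fromℕ b) ⟨
      1ℚ * fromℕ b               ≡⟨ cong (_* fromℕ b) (unit-* m) ⟨
      u * fromℕ m * fromℕ b      ≡⟨ *-assoc u (fromℕ m) (fromℕ b) ⟩
      u * (fromℕ m * fromℕ b)    ≡⟨ cong (u *_) (fromℕ-* m b) ⟨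
      u * fromℕ (m ℕ.* b)        ≤⟨ *-monoˡ-≤-nonNeg u {{nonNegative 0≤u}} (fromℕ-mono few) ⟩
      u * X                      ∎

open Rationals using
  (unit; fromℕ-mono; below<above; below-≤; /-mono; /-complement; most-good; bracket; n<2^n; 2^-lower; ^--lower)

open import Data.Nat.Base
open import Data.Nat.Properties

private variable
  A B C I X Y : Set

-- Sums over lists

bit : Bool → ℕ
bit false = 0
bit true  = 1

infix 6.5 ∑
∑ : List A → (A → ℕ) → ℕ
∑ []       f = 0
∑ (x ∷ xs) f = f x + ∑ xs f

syntax ∑ xs (λ x → e) = ∑[ x ← xs ] e

+-interchange : ∀ a b c d → (a + b) + (c + d) ≡ (a + c) + (b + d)
+-interchange = solve-∀

∑-cong : ∀ (xs : List A) {f g} → (∀ x → f x ≡ g x) → ∑ xs f ≡ ∑ xs g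
∑-cong []       f≡g = refl
∑-cong (x ∷ xs) f≡g = cong₂ _+_ (f≡g x) (∑-cong xs f≡g)

∑-mono : ∀ (xs : List A) {f g} → (∀ x → f x ≤ g x) → ∑ xs f ≤ ∑ xs g
∑-mono []       f≤g = z≤n
∑-mono (x ∷ xs) f≤g = +-mono-≤ (f≤g x) (∑-mono xs f≤g)

∑-+ : ∀ (xs : List A) f g → ∑[ x ← xs ] (f x + g x) ≡ ∑ xs f + ∑ xs g
∑-+ []       f g = refl
∑-+ (x ∷ xs) f g = trans (cong (f x + g x +_) (∑-+ xs f g))
  (+-interchange (f x) (g x) (∑ xs f) (∑ xs g))

∑-* : ∀ c (xs : List A) f → ∑[ x ← xs ] (c * f x) ≡ c * ∑ xs f
∑-* c []       f = sym (*-zeroʳ c)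
∑-* c (x ∷ xs) f = trans (cong (c * f x +_) (∑-* c xs f)) (sym (*-distribˡ-+ c (f x) (∑ xs f)))

∑-const : ∀ (xs : List A) c → ∑[ _ ← xs ] c ≡ length xs * c
∑-const []       c = refl
∑-const (x ∷ xs) c = cong (c +_) (∑-const xs c)

∑-swap : ∀ (xs : List A) (ys : List B) (f : A → B → ℕ) →
         ∑[ x ← xs ] ∑[ y ← ys ] f x y ≡ ∑[ y ← ys ] ∑[ x ← xs ] f x y
∑-swap []       ys f = sym (trans (∑-const ys 0) (*-zeroʳ (length ys)))
∑-swap (x ∷ xs) ys f = trans (cong (∑ ys (f x) +_) (∑-swap xs ys f))
  (sym (∑-+ ys (f x) (λ y → ∑[ x ← xs ] f x y)))

∑-++ : ∀ (xs ys : List A) f → ∑ (xs ++ ys) f ≡ ∑ xs f + ∑ ys f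
∑-++ []       ys f = refl
∑-++ (x ∷ xs) ys f = trans (cong (f x +_) (∑-++ xs ys f)) (sym (+-assoc (f x) (∑ xs f) (∑ ys f)))

∑-map : ∀ (g : A → B) xs f → ∑ (map g xs) f ≡ ∑ xs (f ∘ g)
∑-map g []       f = refl
∑-map g (x ∷ xs) f = cong (f (g x) +_) (∑-map g xs f)

∑-cartesianProduct : ∀ (xs : List A) (ys : List B) f →
  ∑ (cartesianProduct xs ys) f ≡ ∑[ x ← xs ] ∑[ y ← ys ] f (x , y)
∑-cartesianProduct []       ys f = refl
∑-cartesianProduct (x ∷ xs) ys f = trans (∑-++ (map (x ,_) ys) (cartesianProduct xs ys) f)
  (cong₂ _+_ (∑-map (x ,_) ys f) (∑-cartesianProduct xs ys f))

length-filter-∑ : ∀ {P : Pred A 0ℓ} (P? : Decidable P) xs →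
                  length (filter P? xs) ≡ ∑[ x ← xs ] bit (does (P? x))
length-filter-∑ P? [] = refl
length-filter-∑ P? (x ∷ xs) with does (P? x)
... | true  = cong suc (length-filter-∑ P? xs)
... | false = length-filter-∑ P? xs

∑-filter : ∀ {P : Pred A 0ℓ} (P? : Decidable P) xs f →
           ∑ (filter P? xs) f ≡ ∑[ x ← xs ] (bit (does (P? x)) * f x)
∑-filter P? [] f = refl
∑-filter P? (x ∷ xs) f with does (P? x)
... | true  = cong₂ _+_ (sym (*-identityˡ (f x))) (∑-filter P? xs f)
... | false = ∑-filter P? xs f

-- Averaging without division. Here and in `∑ᵛ-min` the random choices of the argument become actual
-- choices.
∑-min : ∀ (xs : List A) f → 0 < length xs → ∃[ x ] length xs * f x ≤ ∑ xs f
∑-min (x ∷ [])         f _ = x , ≤-refl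
∑-min (x ∷ xs@(_ ∷ _)) f _ with ∑-min xs f (s≤s z≤n)
... | y , le with ≤-total (f x) (f y)
...   | inj₁ fx≤fy = x , +-monoʳ-≤ (f x) (≤-trans (*-monoʳ-≤ (length xs) fx≤fy) le)
...   | inj₂ fy≤fx = y , +-mono-≤ fy≤fx le

-- The expectation over `s` independent uniform samples, repetitions allowed, scaled by
-- `length xs ^ s`.
∑ᵛ : List A → ∀ s → (Vec A s → ℕ) → ℕ
∑ᵛ xs zero    f = f []
∑ᵛ xs (suc s) f = ∑[ x ← xs ] ∑ᵛ xs s (f ∘ (x ∷_))

∑ᵛ-cong : ∀ (xs : List A) s {f g} → (∀ v → f v ≡ g v) → ∑ᵛ xs s f ≡ ∑ᵛ xs s g
∑ᵛ-cong xs zero    f≡g = f≡g []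
∑ᵛ-cong xs (suc s) f≡g = ∑-cong xs λ x → ∑ᵛ-cong xs s (f≡g ∘ (x ∷_))

∑ᵛ-mono : ∀ (xs : List A) s {f g} → (∀ v → f v ≤ g v) → ∑ᵛ xs s f ≤ ∑ᵛ xs s g
∑ᵛ-mono xs zero    f≤g = f≤g []
∑ᵛ-mono xs (suc s) f≤g = ∑-mono xs λ x → ∑ᵛ-mono xs s (f≤g ∘ (x ∷_))

∑ᵛ-+ : ∀ (xs : List A) s f g → ∑ᵛ xs s (λ v → f v + g v) ≡ ∑ᵛ xs s f + ∑ᵛ xs s g
∑ᵛ-+ xs zero    f g = refl
∑ᵛ-+ xs (suc s) f g = trans (∑-cong xs λ x → ∑ᵛ-+ xs s (f ∘ (x ∷_)) (g ∘ (x ∷_)))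
  (∑-+ xs (λ x → ∑ᵛ xs s (f ∘ (x ∷_))) (λ x → ∑ᵛ xs s (g ∘ (x ∷_))))

∑ᵛ-const : ∀ (xs : List A) s c → ∑ᵛ xs s (const c) ≡ c * length xs ^ s
∑ᵛ-const xs zero    c = sym (*-identityʳ c)
∑ᵛ-const xs (suc s) c = trans (∑-cong xs λ _ → ∑ᵛ-const xs s c)
  (trans (∑-const xs _) (lemma (length xs) c (length xs ^ s)))
  where
  lemma : ∀ a b c → a * (b * c) ≡ b * (a * c)
  lemma = solve-∀

∑-∑ᵛ-swap : ∀ (xs : List A) (ys : List B) s (f : A → Vec B s → ℕ) →
            ∑[ x ← xs ] ∑ᵛ ys s (f x) ≡ ∑ᵛ ys s (λ v → ∑[ x ← xs ] f x v)
∑-∑ᵛ-swap xs ys zero    f = refl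
∑-∑ᵛ-swap xs ys (suc s) f = trans (∑-swap xs ys λ x y → ∑ᵛ ys s (f x ∘ (y ∷_)))
  (∑-cong ys λ y → ∑-∑ᵛ-swap xs ys s λ x → f x ∘ (y ∷_))

∑ᵛ-min : ∀ (xs : List A) s f → 0 < length xs → ∃[ v ] length xs ^ s * f v ≤ ∑ᵛ xs s f
∑ᵛ-min xs zero    f pos = [] , ≤-reflexive (+-identityʳ (f []))
∑ᵛ-min {A} xs (suc s) f pos = x ∷ v x , (begin
  length xs * length xs ^ s * f (x ∷ v x)    ≡⟨ *-assoc (length xs) _ _ ⟩
  length xs * (length xs ^ s * f (x ∷ v x))  ≤⟨ x-min ⟩
  ∑[ x ← xs ] (length xs ^ s * f (x ∷ v x))  ≤⟨ ∑-mono xs (λ x → proj₂ (rest x)) ⟩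
  ∑ᵛ xs (suc s) f                            ∎)
  where
  open ≤-Reasoning
  rest : ∀ x → ∃[ v ] length xs ^ s * f (x ∷ v) ≤ ∑ᵛ xs s (f ∘ (x ∷_))
  rest x = ∑ᵛ-min xs s (f ∘ (x ∷_)) pos
  v = proj₁ ∘ rest
  best : ∃[ x ] length xs * (length xs ^ s * f (x ∷ v x)) ≤ ∑[ x ← xs ] (length xs ^ s * f (x ∷ v x))
  best = ∑-min xs _ pos
  x = proj₁ best
  x-min = proj₂ best

-- Haussler's edge bound on the cube

Weight : ℕ → Set
Weight s = Vec Bool s → ℕ

face : ∀ {s} → Bool → Weight (suc s) → Weight s
face b w = w ∘ (b ∷_)

infixl 7 _⊓ʷ_
infixl 6 _⊔ʷ_
_⊓ʷ_ _⊔ʷ_ : ∀ {s} → Weight s → Weight s → Weight s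
(w ⊓ʷ w′) v = w v ⊓ w′ v
(w ⊔ʷ w′) v = w v ⊔ w′ v

mass : ∀ {s} → Weight s → ℕ
mass {zero}  w = w []
mass {suc s} w = mass (face false w) + mass (face true w)

-- The weighted edge count of the one-inclusion graph: first the edges in the direction of the first
-- coordinate, then those inside the two faces.
edgeMass : ∀ {s} → Weight s → ℕ
edgeMass {zero}  w = 0
edgeMass {suc s} w = mass (face false w ⊓ʷ face true w) + (edgeMass (face false w) + edgeMass (face true w))

-- The support of w shatters k coordinates: a coordinate left out is projected
-- away (⊔ʷ), a chosen one must be free to take both values (⊓ʷ).
ShattersDim : ∀ {s} → ℕ → Weight s → Set
ShattersDim         zero    w = ∃[ v ] 0 < w v
ShattersDim {zero}  (suc k) w = ⊥
ShattersDim {suc s} (suc k) w =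
  ShattersDim (suc k) (face false w ⊔ʷ face true w) ⊎ ShattersDim k (face false w ⊓ʷ face true w)

mass-mono : ∀ {s} {w w′ : Weight s} → (∀ v → w v ≤ w′ v) → mass w ≤ mass w′
mass-mono {zero}  w≤w′ = w≤w′ []
mass-mono {suc s} w≤w′ = +-mono-≤ (mass-mono (w≤w′ ∘ (false ∷_))) (mass-mono (w≤w′ ∘ (true ∷_)))

mass-zero : ∀ {s} {w : Weight s} → (∀ v → w v ≡ 0) → mass w ≡ 0
mass-zero {zero}  w≡0 = w≡0 []
mass-zero {suc s} w≡0 = cong₂ _+_ (mass-zero (w≡0 ∘ (false ∷_))) (mass-zero (w≡0 ∘ (true ∷_)))

mass-+ : ∀ {s} (w w′ : Weight s) → mass (λ v → w v + w′ v) ≡ mass w + mass w′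
mass-+ {zero}  w w′ = refl
mass-+ {suc s} w w′ = trans (cong₂ _+_ (mass-+ (face false w) (face false w′)) (mass-+ (face true w) (face true w′)))
  (+-interchange (mass (face false w)) _ _ _)

⊔+⊓ : ∀ a b → a + b ≡ (a ⊔ b) + (a ⊓ b)
⊔+⊓ a b with ≤-total a b
... | inj₁ a≤b rewrite m≤n⇒m⊔n≡n a≤b | m≤n⇒m⊓n≡m a≤b = +-comm a b
... | inj₂ b≤a rewrite m≥n⇒m⊔n≡m b≤a | m≥n⇒m⊓n≡n b≤a = refl

mass-cong : ∀ {s} {w w′ : Weight s} → (∀ v → w v ≡ w′ v) → mass w ≡ mass w′
mass-cong {zero}  eq = eq []
mass-cong {suc s} eq = cong₂ _+_ (mass-cong (eq ∘ (false ∷_))) (mass-cong (eq ∘ (true ∷_)))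

mass-⊔-⊓ : ∀ {s} (w w′ : Weight s) → mass w + mass w′ ≡ mass (w ⊔ʷ w′) + mass (w ⊓ʷ w′)
mass-⊔-⊓ w w′ = trans (sym (mass-+ w w′))
  (trans (mass-cong λ v → ⊔+⊓ (w v) (w′ v)) (mass-+ (w ⊔ʷ w′) (w ⊓ʷ w′)))

-- Write the two minima as their maximum plus their minimum. Monotonicity of `⊔` and `⊓` bounds the
-- maximum by the first summand and the minimum by the second.
⊓-supermodular : ∀ a b c d → (a ⊓ b) + (c ⊓ d) ≤ ((a ⊔ c) ⊓ (b ⊔ d)) + ((a ⊓ c) ⊓ (b ⊓ d))
⊓-supermodular a b c d = begin
  (a ⊓ b) + (c ⊓ d)                              ≡⟨ ⊔+⊓ (a ⊓ b) (c ⊓ d) ⟩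
  ((a ⊓ b) ⊔ (c ⊓ d)) + ((a ⊓ b) ⊓ (c ⊓ d))      ≤⟨ +-mono-≤ upper lower ⟩
  ((a ⊔ c) ⊓ (b ⊔ d)) + ((a ⊓ c) ⊓ (b ⊓ d))      ∎
  where
  open ≤-Reasoning
  upper : (a ⊓ b) ⊔ (c ⊓ d) ≤ (a ⊔ c) ⊓ (b ⊔ d)
  upper = ⊓-glb (⊔-mono-≤ (m⊓n≤m a b) (m⊓n≤m c d)) (⊔-mono-≤ (m⊓n≤n a b) (m⊓n≤n c d))
  lower : (a ⊓ b) ⊓ (c ⊓ d) ≤ (a ⊓ c) ⊓ (b ⊓ d)
  lower = ⊓-glb (⊓-mono-≤ (m⊓n≤m a b) (m⊓n≤m c d)) (⊓-mono-≤ (m⊓n≤n a b) (m⊓n≤n c d))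

-- Holds edge by edge: `⊓-supermodular` handles the edges in the first direction, induction those
-- inside the faces.
edgeMass-⊔-⊓ : ∀ {s} (w w′ : Weight s) → edgeMass w + edgeMass w′ ≤ edgeMass (w ⊔ʷ w′) + edgeMass (w ⊓ʷ w′)
edgeMass-⊔-⊓ {zero}  w w′ = z≤n
edgeMass-⊔-⊓ {suc s} w w′ = begin
  (mass (w₀ ⊓ʷ w₁) + (edgeMass w₀ + edgeMass w₁)) + (mass (w₀′ ⊓ʷ w₁′) + (edgeMass w₀′ + edgeMass w₁′))
    ≡⟨ regroup (mass (w₀ ⊓ʷ w₁)) (edgeMass w₀) (edgeMass w₁) (mass (w₀′ ⊓ʷ w₁′)) (edgeMass w₀′) (edgeMass w₁′) ⟩
  (mass (w₀ ⊓ʷ w₁) + mass (w₀′ ⊓ʷ w₁′)) + ((edgeMass w₀ + edgeMass w₀′) + (edgeMass w₁ + edgeMass w₁′))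
    ≤⟨ +-mono-≤ crossing (+-mono-≤ (edgeMass-⊔-⊓ w₀ w₀′) (edgeMass-⊔-⊓ w₁ w₁′)) ⟩
  (mass u + mass u′) + ((edgeMass (w₀ ⊔ʷ w₀′) + edgeMass (w₀ ⊓ʷ w₀′)) + (edgeMass (w₁ ⊔ʷ w₁′) + edgeMass (w₁ ⊓ʷ w₁′)))
    ≡⟨ regroup (mass u) (edgeMass (w₀ ⊔ʷ w₀′)) (edgeMass (w₁ ⊔ʷ w₁′)) (mass u′) (edgeMass (w₀ ⊓ʷ w₀′)) (edgeMass (w₁ ⊓ʷ w₁′)) ⟨
  edgeMass (w ⊔ʷ w′) + edgeMass (w ⊓ʷ w′) ∎
  where
  open ≤-Reasoning
  w₀ w₁ w₀′ w₁′ u u′ : Weight s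
  w₀  = face false w
  w₁  = face true w
  w₀′ = face false w′
  w₁′ = face true w′
  u   = (w₀ ⊔ʷ w₀′) ⊓ʷ (w₁ ⊔ʷ w₁′)
  u′  = (w₀ ⊓ʷ w₀′) ⊓ʷ (w₁ ⊓ʷ w₁′)
  regroup : ∀ a b c d e f → (a + (b + c)) + (d + (e + f)) ≡ (a + d) + ((b + e) + (c + f))
  regroup = solve-∀
  crossing : mass (w₀ ⊓ʷ w₁) + mass (w₀′ ⊓ʷ w₁′) ≤ mass u + mass u′
  crossing = begin
    mass (w₀ ⊓ʷ w₁) + mass (w₀′ ⊓ʷ w₁′)                 ≡⟨ mass-+ (w₀ ⊓ʷ w₁) (w₀′ ⊓ʷ w₁′) ⟨
    mass (λ v → (w₀ ⊓ʷ w₁) v + (w₀′ ⊓ʷ w₁′) v)          ≤⟨ mass-mono (λ v → ⊓-supermodular (w₀ v) (w₁ v) (w₀′ v) (w₁′ v)) ⟩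
    mass (λ v → u v + u′ v)                             ≡⟨ mass-+ u u′ ⟩
    mass u + mass u′                                    ∎

edgeMass-zero : ∀ {s} {w : Weight s} → (∀ v → w v ≡ 0) → edgeMass w ≡ 0
edgeMass-zero {zero}  w≡0 = refl
edgeMass-zero {suc s} {w} w≡0 = cong₂ _+_
  (mass-zero λ v → cong₂ _⊓_ (w≡0 (false ∷ v)) (w≡0 (true ∷ v)))
  (cong₂ _+_ (edgeMass-zero (w≡0 ∘ (false ∷_))) (edgeMass-zero (w≡0 ∘ (true ∷_))))

-- Replace the two faces by their maximum `M` and minimum `m`; this keeps the mass and does not
-- lower the edge mass. `M` shatters no `suc k` coordinates and `m` no `k`, since the removed
-- coordinate would be one more. The edges between the faces have mass exactly `mass m`, which
-- raises the coefficient of `mass m` from `k` to `suc k`.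
edgeMass-bound : ∀ {s} k (w : Weight s) → ¬ ShattersDim k w → edgeMass w ≤ k * mass w
edgeMass-bound         zero    w ¬sh = ≤-reflexive (edgeMass-zero λ v → n≤0⇒n≡0 (≮⇒≥ λ 0<w → ¬sh (v , 0<w)))
edgeMass-bound {zero}  (suc k) w ¬sh = z≤n
edgeMass-bound {suc s} (suc k) w ¬sh = begin
  mass m + (edgeMass w₀ + edgeMass w₁)               ≤⟨ +-monoʳ-≤ (mass m) (edgeMass-⊔-⊓ w₀ w₁) ⟩
  mass m + (edgeMass M + edgeMass m)                 ≤⟨ +-monoʳ-≤ (mass m)
    (+-mono-≤ (edgeMass-bound (suc k) M (¬sh ∘ inj₁)) (edgeMass-bound k m (¬sh ∘ inj₂))) ⟩
  mass m + (suc k * mass M + k * mass m)             ≡⟨ regroup k (mass M) (mass m) ⟩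
  suc k * (mass M + mass m)                          ≡⟨ cong (suc k *_) (mass-⊔-⊓ w₀ w₁) ⟨
  suc k * mass w                                     ∎
  where
  open ≤-Reasoning
  w₀ w₁ M m : Weight s
  w₀ = face false w
  w₁ = face true w
  M  = w₀ ⊔ʷ w₁
  m  = w₀ ⊓ʷ w₁
  regroup : ∀ k a b → b + (suc k * a + k * b) ≡ suc k * (a + b)
  regroup = solve-∀

m<n⊔o⇒m<n⊎m<o : ∀ {m} n o → m < n ⊔ o → m < n ⊎ m < o
m<n⊔o⇒m<n⊎m<o n o lt with ≤-total n o
... | inj₁ n≤o = inj₂ (subst (_ <_) (m≤n⇒m⊔n≡n n≤o) lt)
... | inj₂ o≤n = inj₁ (subst (_ <_) (m≥n⇒m⊔n≡m o≤n) lt)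

-- A positive maximum is positive on one of the faces, which fixes the bit at a skipped coordinate.
-- A positive minimum is positive on both, so the bit at a chosen coordinate is free.
shattersDim⇒coordinates : ∀ {s} k (w : Weight s) → ShattersDim k w →
  Σ[ c ∈ (Fin k → Fin s) ] ∀ (p : Vec Bool k) → ∃[ v ] (0 < w v × ∀ i → lookup v (c i) ≡ lookup p i)
shattersDim⇒coordinates zero w (v , 0<w) = (λ ()) , λ _ → v , 0<w , λ ()
shattersDim⇒coordinates {suc s} (suc k) w (inj₁ sh)
  with c , pattern-at ← shattersDim⇒coordinates (suc k) _ sh = suc ∘ c , at
  where
  at : ∀ p → ∃[ v ] (0 < w v × ∀ i → lookup v (suc (c i)) ≡ lookup p i)
  at p with v , 0<⊔ , eq ← pattern-at p with m<n⊔o⇒m<n⊎m<o (w (false ∷ v)) (w (true ∷ v)) 0<⊔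
  ... | inj₁ 0<w = false ∷ v , 0<w , eq
  ... | inj₂ 0<w = true ∷ v , 0<w , eq
shattersDim⇒coordinates {suc s} (suc k) w (inj₂ sh)
  with c , pattern-at ← shattersDim⇒coordinates k _ sh = c′ , at
  where
  c′ : Fin (suc k) → Fin (suc s)
  c′ zero    = zero
  c′ (suc i) = suc (c i)
  at : ∀ p → ∃[ v ] (0 < w v × ∀ i → lookup v (c′ i) ≡ lookup p i)
  at (b ∷ p) with v , 0<⊓ , eq ← pattern-at p = b ∷ v , positive b , λ { zero → refl ; (suc i) → eq i }
    where
    positive : ∀ b → 0 < w (b ∷ v)
    positive false = ≤-trans 0<⊓ (m⊓n≤m (w (false ∷ v)) (w (true ∷ v)))
    positive true  = ≤-trans 0<⊓ (m⊓n≤n (w (false ∷ v)) (w (true ∷ v)))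

-- Traces on a random sample

filter-comm : ∀ {P Q : Pred A 0ℓ} (P? : Decidable P) (Q? : Decidable Q) xs →
              filter P? (filter Q? xs) ≡ filter Q? (filter P? xs)
filter-comm P? Q? [] = refl
filter-comm P? Q? (x ∷ xs) with does (P? x) in p | does (Q? x) in q
... | true  | true  rewrite p | q = cong (x ∷_) (filter-comm P? Q? xs)
... | true  | false rewrite q = filter-comm P? Q? xs
... | false | true  rewrite p = filter-comm P? Q? xs
... | false | false = filter-comm P? Q? xs

∑-filter-cong : ∀ {P : Pred A 0ℓ} (P? : Decidable P) xs {f g} → (∀ {x} → P x → f x ≡ g x) →
                ∑ (filter P? xs) f ≡ ∑ (filter P? xs) g
∑-filter-cong P? [] f≡g = refl
∑-filter-cong P? (x ∷ xs) f≡g with P? x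
... | yes px = cong₂ _+_ (f≡g px) (∑-filter-cong P? xs f≡g)
... | no  _  = ∑-filter-cong P? xs f≡g

select : Bool → (X → Bool) → List X → List X
select b a = filter λ x → a x Bool.≟ b

∑-select : ∀ (a : X → Bool) xs f → ∑ (select false a xs) f + ∑ (select true a xs) f ≡ ∑ xs f
∑-select a [] f = refl
∑-select a (x ∷ xs) f with a x
... | false = trans (+-assoc (f x) _ _) (cong (f x +_) (∑-select a xs f))
... | true  = trans (x∙yz≈y∙xz (∑ (select false a xs) f) (f x) _) (cong (f x +_) (∑-select a xs f))
  where open import Algebra.Properties.CommutativeSemigroup +-commutativeSemigroup using (x∙yz≈y∙xz)

length-∑ : ∀ (xs : List A) → length xs ≡ ∑[ _ ← xs ] 1
length-∑ []       = refl
length-∑ (x ∷ xs) = cong suc (length-∑ xs)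

length-select : ∀ (a : X → Bool) xs → length (select false a xs) + length (select true a xs) ≡ length xs
length-select a xs = begin
  length (select false a xs) + length (select true a xs) ≡⟨ cong₂ _+_ (length-∑ (select false a xs)) (length-∑ (select true a xs)) ⟩
  _                                                      ≡⟨ ∑-select a xs (const 1) ⟩
  ∑[ _ ← xs ] 1                                          ≡⟨ length-∑ xs ⟨
  length xs                                              ∎
  where open ≡-Reasoning

-- A pattern `Vec Bool k` is also a `Subset k`, so the row realising it can later serve as the
-- vertex of that subset in `Shatters`.
RowsShatter : (X → Y → Bool) → ℕ → Set
RowsShatter {X} {Y} A k = Σ[ a ∈ (Fin k → Y) ] ∀ (p : Vec Bool k) → ∃[ x ] ∀ i → A x (a i) ≡ lookup p i

module Traces (A : X → Y → Bool) where

  column : Y → X → Bool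
  column y x = A x y

  trace : ∀ {s} → Vec Y s → X → Vec Bool s
  trace ys x = Vec.map (A x) ys

  -- Recursion on the sample, rather than counting equal traces, makes each face of this weight
  -- definitionally the weight of a sublist of the rows.
  #trace : ∀ {s} → List X → Vec Y s → Weight s
  #trace xs []       []      = length xs
  #trace xs (y ∷ ys) (b ∷ v) = #trace (select b (column y) xs) ys v

  -- The least number of errors in guessing `a` from the trace on `ys`. For `a = column y` it is
  -- also the mass of the cube edges in direction `y` once `y` joins the sample; this double reading
  -- links prediction to `edgeMass`.
  impurity : ∀ {s} → List X → Vec Y s → (X → Bool) → ℕ
  impurity xs ys a = mass (#trace (select false a xs) ys ⊓ʷ #trace (select true a xs) ys)

  mass-#trace : ∀ {s} xs (ys : Vec Y s) → mass (#trace xs ys) ≡ length xs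
  mass-#trace xs []       = refl
  mass-#trace xs (y ∷ ys) = trans
    (cong₂ _+_ (mass-#trace (select false (column y) xs) ys) (mass-#trace (select true (column y) xs) ys))
    (length-select (column y) xs)

  impurity-∷ : ∀ {s} xs y (ys : Vec Y s) a →
    impurity xs (y ∷ ys) a ≡
      impurity (select false (column y) xs) ys a + impurity (select true (column y) xs) ys a
  impurity-∷ xs y ys a = cong₂ _+_ (swapped false) (swapped true)
    where
    swapped : ∀ b →
      mass (#trace (select b (column y) (select false a xs)) ys ⊓ʷ #trace (select b (column y) (select true a xs)) ys)
        ≡ impurity (select b (column y) xs) ys a
    swapped b = cong₂ (λ us vs → mass (#trace us ys ⊓ʷ #trace vs ys))
      (filter-comm _ _ xs) (filter-comm _ _ xs)

  0<#trace⇒∈ : ∀ {s} xs (ys : Vec Y s) v → 0 < #trace xs ys v → ∃[ x ] (x ∈ xs × trace ys x ≡ v)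
  0<#trace⇒∈ []       []       []      ()
  0<#trace⇒∈ (x ∷ xs) []       []      _   = x , here refl , refl
  0<#trace⇒∈ xs       (y ∷ ys) (b ∷ v) pos
    with x , x∈ , eq ← 0<#trace⇒∈ (select b (column y) xs) ys v pos
    with x∈xs , Axy≡b ← ∈-filter⁻ (λ x → A x y Bool.≟ b) x∈ = x , x∈xs , cong₂ _∷_ Axy≡b eq

  shattersDim⇒rowsShatter : ∀ {s} k xs (ys : Vec Y s) → ShattersDim k (#trace xs ys) → RowsShatter A k
  shattersDim⇒rowsShatter k xs ys sh with c , at ← shattersDim⇒coordinates k (#trace xs ys) sh =
    (λ i → lookup ys (c i)) , realise
    where
    realise : ∀ p → ∃[ x ] ∀ i → A x (lookup ys (c i)) ≡ lookup p i
    realise p with v , pos , eq ← at p with x , _ , refl ← 0<#trace⇒∈ xs ys v pos =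
      x , λ i → trans (sym (lookup-map (c i) (A x) ys)) (eq i)

  -- Splitting along the sample columns leads to a class of rows with equal trace. There the more
  -- frequent value of `a` is guessed, and the errors are the minority.
  majority : ∀ {s} xs (ys : Vec Y s) a →
    Σ[ h ∈ (Vec Bool s → Bool) ] ∑[ x ← xs ] bit (a x xor h (trace ys x)) ≤ impurity xs ys a
  majority xs [] a with ≤-total (length (select false a xs)) (length (select true a xs))
  ... | inj₁ f≤t = const true , ≤-reflexive (trans
    (trans (∑-cong xs wrong) (sym (length-filter-∑ (λ x → a x Bool.≟ false) xs))) (sym (m≤n⇒m⊓n≡m f≤t)))
    where
    wrong : ∀ x → bit (a x xor true) ≡ bit (does (a x Bool.≟ false))
    wrong x with a x
    ... | false = refl
    ... | true  = refl
  ... | inj₂ t≤f = const false , ≤-reflexive (trans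
    (trans (∑-cong xs wrong) (sym (length-filter-∑ (λ x → a x Bool.≟ true) xs))) (sym (m≥n⇒m⊓n≡n t≤f)))
    where
    wrong : ∀ x → bit (a x xor false) ≡ bit (does (a x Bool.≟ true))
    wrong x with a x
    ... | false = refl
    ... | true  = refl
  majority xs (y ∷ ys) a = h , (begin
    ∑ xs mistake
      ≡⟨ ∑-select (column y) xs mistake ⟨
    ∑ (part false) mistake + ∑ (part true) mistake
      ≡⟨ cong₂ _+_ (∑-filter-cong _ xs (known false)) (∑-filter-cong _ xs (known true)) ⟩
    ∑[ x ← part false ] bit (a x xor proj₁ (hs false) (trace ys x)) +
      ∑[ x ← part true ] bit (a x xor proj₁ (hs true) (trace ys x))
      ≤⟨ +-mono-≤ (proj₂ (hs false)) (proj₂ (hs true)) ⟩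
    impurity (part false) ys a + impurity (part true) ys a
      ≡⟨ impurity-∷ xs y ys a ⟨
    impurity xs (y ∷ ys) a ∎)
    where
    open ≤-Reasoning
    part : Bool → List X
    part b = select b (column y) xs
    hs : ∀ b → Σ[ h ∈ (Vec Bool _ → Bool) ] ∑[ x ← part b ] bit (a x xor h (trace ys x)) ≤ impurity (part b) ys a
    hs b = majority (part b) ys a
    h : Vec Bool _ → Bool
    h (b ∷ v) = proj₁ (hs b) v
    mistake : X → ℕ
    mistake x = bit (a x xor h (trace (y ∷ ys) x))
    known : ∀ b {x} → A x y ≡ b → mistake x ≡ bit (a x xor proj₁ (hs b) (trace ys x))
    known b {x} eq = cong (λ c → bit (a x xor h (c ∷ trace ys x))) eq

  module _ (V : List Y) where

    totalImpurity : ℕ → List X → ℕ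
    totalImpurity s xs = ∑ᵛ V s λ ys → ∑[ y ← V ] impurity xs ys (column y)

    totalImpurity-suc : ∀ s xs → totalImpurity (suc s) xs ≡
      ∑[ y ← V ] (totalImpurity s (select false (column y) xs) + totalImpurity s (select true (column y) xs))
    totalImpurity-suc s xs = ∑-cong V λ y → trans
      (∑ᵛ-cong V s λ ys → trans (∑-cong V λ y′ → impurity-∷ xs y ys (column y′))
        (∑-+ V (λ y′ → impurity (half false y) ys (column y′)) (λ y′ → impurity (half true y) ys (column y′))))
      (∑ᵛ-+ V s (λ ys → ∑[ y′ ← V ] impurity (half false y) ys (column y′))
        (λ ys → ∑[ y′ ← V ] impurity (half true y) ys (column y′)))
      where
      half : Bool → Y → List X
      half b y = select b (column y) xs

    totalEdgeMass : ℕ → List X → ℕ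
    totalEdgeMass s xs = ∑ᵛ V s λ ys → edgeMass (#trace xs ys)

    -- The edges in the direction of the first sampled column give the impurity term; exchanging the
    -- sums turns that column into the one to be predicted.
    totalEdgeMass-suc : ∀ s xs → totalEdgeMass (suc s) xs ≡ totalImpurity s xs +
      ∑[ y ← V ] (totalEdgeMass s (select false (column y) xs) + totalEdgeMass s (select true (column y) xs))
    totalEdgeMass-suc s xs = begin
      totalEdgeMass (suc s) xs
        ≡⟨ ∑-cong V (λ y → trans
          (∑ᵛ-+ V s (λ ys → impurity xs ys (column y)) (λ ys → halfEdgeMass false y ys + halfEdgeMass true y ys))
          (cong (∑ᵛ V s (λ ys → impurity xs ys (column y)) +_) (∑ᵛ-+ V s (halfEdgeMass false y) (halfEdgeMass true y)))) ⟩
      ∑[ y ← V ] (∑ᵛ V s (λ ys → impurity xs ys (column y)) + rest y)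
        ≡⟨ ∑-+ V (λ y → ∑ᵛ V s (λ ys → impurity xs ys (column y))) rest ⟩
      ∑[ y ← V ] ∑ᵛ V s (λ ys → impurity xs ys (column y)) + ∑ V rest
        ≡⟨ cong (_+ ∑ V rest) (∑-∑ᵛ-swap V V s λ y ys → impurity xs ys (column y)) ⟩
      totalImpurity s xs + ∑ V rest ∎
      where
      open ≡-Reasoning
      halfEdgeMass : Bool → Y → Vec Y s → ℕ
      halfEdgeMass b y ys = edgeMass (#trace (select b (column y) xs) ys)
      rest : Y → ℕ
      rest y = totalEdgeMass s (select false (column y) xs) + totalEdgeMass s (select true (column y) xs)

    -- Exchangeability: each of the `suc s` directions of a random sample contributes the same. The
    -- first contributes `totalImpurity` outright; induction on the two halves of the rows covers
    -- the others, and `totalImpurity-suc` reassembles them.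
    totalEdgeMass≡ : ∀ s xs → totalEdgeMass (suc s) xs ≡ suc s * totalImpurity s xs
    totalEdgeMass≡ zero    xs = trans (totalEdgeMass-suc zero xs)
      (cong (totalImpurity 0 xs +_) (trans (∑-const V 0) (*-zeroʳ (length V))))
    totalEdgeMass≡ (suc s) xs = trans (totalEdgeMass-suc (suc s) xs) (cong (totalImpurity (suc s) xs +_) (begin
      ∑[ y ← V ] (totalEdgeMass (suc s) (select false (column y) xs) + totalEdgeMass (suc s) (select true (column y) xs))
        ≡⟨ ∑-cong V (λ y → trans (cong₂ _+_ (totalEdgeMass≡ s (half false y)) (totalEdgeMass≡ s (half true y)))
          (sym (*-distribˡ-+ (suc s) (totalImpurity s (half false y)) (totalImpurity s (half true y))))) ⟩
      ∑[ y ← V ] (suc s * (totalImpurity s (select false (column y) xs) + totalImpurity s (select true (column y) xs)))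
        ≡⟨ ∑-* (suc s) V _ ⟩
      suc s * (∑[ y ← V ] (totalImpurity s (select false (column y) xs) + totalImpurity s (select true (column y) xs)))
        ≡⟨ cong (suc s *_) (totalImpurity-suc s xs) ⟨
      suc s * totalImpurity (suc s) xs ∎))
      where
      open ≡-Reasoning
      half : Bool → Y → List X
      half b y = select b (column y) xs

    -- For every sample the trace weight has mass `length xs` and shatters no `k` coordinates, so
    -- `edgeMass-bound` applies to each term of `totalEdgeMass`.
    totalImpurity-bound : ∀ k s xs → ¬ RowsShatter A k →
      suc s * totalImpurity s xs ≤ k * length xs * length V ^ suc s
    totalImpurity-bound k s xs ¬sh = begin
      suc s * totalImpurity s xs          ≡⟨ totalEdgeMass≡ s xs ⟨
      totalEdgeMass (suc s) xs            ≤⟨ ∑ᵛ-mono V (suc s) bound ⟩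
      ∑ᵛ V (suc s) (const (k * length xs)) ≡⟨ ∑ᵛ-const V (suc s) (k * length xs) ⟩
      k * length xs * length V ^ suc s    ∎
      where
      open ≤-Reasoning
      bound : ∀ ys → edgeMass (#trace xs ys) ≤ k * length xs
      bound ys = ≤-trans (edgeMass-bound k (#trace xs ys) (¬sh ∘ shattersDim⇒rowsShatter k xs ys))
        (≤-reflexive (cong (k *_) (mass-#trace xs ys)))

module _ (A : I → X → Y → Bool) where
  open Traces using (trace; impurity; column; majority; totalImpurity; totalImpurity-bound)

  -- The expected errors for the matrices `A t` add up, so averaging over the summed error yields
  -- one sample that serves the whole family; only the guess `h` depends on `t`.
  commonSample : ∀ k s (ts : List I) xs (V : List Y) → 0 < length V → (∀ t → ¬ RowsShatter (A t) k) →
    Σ[ ys ∈ Vec Y s ] Σ[ h ∈ (I → Y → Vec Bool s → Bool) ]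
      suc s * (∑[ t ← ts ] ∑[ y ← V ] ∑[ x ← xs ] bit (A t x y xor h t y (trace (A t) ys x)))
        ≤ length ts * (k * length xs * length V)
  commonSample k s ts xs V pos ¬sh = ys , (λ t y → proj₁ (maj t y)) , (begin
    suc s * (∑[ t ← ts ] ∑[ y ← V ] ∑[ x ← xs ] bit (A t x y xor proj₁ (maj t y) (trace (A t) ys x)))
      ≤⟨ *-monoʳ-≤ (suc s) (∑-mono ts λ t → ∑-mono V λ y → proj₂ (maj t y)) ⟩
    suc s * F ys
      ≤⟨ *-cancelˡ-≤ (length V ^ s) scaled ⟩
    length ts * (k * length xs * length V) ∎)
    where
    open ≤-Reasoning
    instance
      _ : NonZero (length V ^ s)
      _ = m^n≢0 (length V) s {{>-nonZero pos}}
    F : Vec Y s → ℕ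
    F ys = ∑[ t ← ts ] ∑[ y ← V ] impurity (A t) xs ys (column (A t) y)
    best : ∃[ ys ] length V ^ s * F ys ≤ ∑ᵛ V s F
    best = ∑ᵛ-min V s F pos
    ys = proj₁ best
    maj = λ t y → majority (A t) xs ys (column (A t) y)
    scaled : length V ^ s * (suc s * F ys) ≤ length V ^ s * (length ts * (k * length xs * length V))
    scaled = begin
      length V ^ s * (suc s * F ys)                           ≡⟨ commute (length V ^ s) (suc s) (F ys) ⟩
      suc s * (length V ^ s * F ys)                           ≤⟨ *-monoʳ-≤ (suc s) (proj₂ best) ⟩
      suc s * ∑ᵛ V s F                                        ≡⟨ cong (suc s *_) (∑-∑ᵛ-swap ts V s _) ⟨
      suc s * (∑[ t ← ts ] totalImpurity (A t) V s xs)          ≡⟨ ∑-* (suc s) ts _ ⟨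
      ∑[ t ← ts ] (suc s * totalImpurity (A t) V s xs)        ≤⟨ ∑-mono ts (λ t → totalImpurity-bound (A t) V k s xs (¬sh t)) ⟩
      ∑[ t ← ts ] (k * length xs * length V ^ suc s)          ≡⟨ ∑-const ts _ ⟩
      length ts * (k * length xs * (length V * length V ^ s)) ≡⟨ regroup (length ts) (k * length xs) (length V) (length V ^ s) ⟩
      length V ^ s * (length ts * (k * length xs * length V)) ∎
      where
      commute : ∀ a b c → a * (b * c) ≡ b * (a * c)
      commute = solve-∀
      regroup : ∀ a b c d → a * (b * (c * d)) ≡ d * (a * (b * c))
      regroup = solve-∀

-- Labelling the vertices

xor-triangle : ∀ a b c → bit (a xor c) ≤ bit (a xor b) + bit (b xor c)
xor-triangle false false c     = ≤-refl
xor-triangle false true  false = z≤n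
xor-triangle false true  true  = ≤-refl
xor-triangle true  false false = ≤-refl
xor-triangle true  false true  = z≤n
xor-triangle true  true  c     = ≤-refl

xor-triangleʳ : ∀ a b c → bit (a xor b) ≤ bit (c xor a) + bit (c xor b)
xor-triangleʳ a b c = subst (λ d → bit (a xor b) ≤ bit d + bit (c xor b)) (Bool.xor-comm a c) (xor-triangle a c b)

bit≤1 : ∀ b → bit b ≤ 1
bit≤1 false = z≤n
bit≤1 true  = ≤-refl

-- If `u` and `v` agree on all of `ws`, the two arguments of `H` coincide. Otherwise the sum is
-- already at least 1.
xor-perturb : ∀ {r} c (H : Vec Bool r → Bool) (u v : A → Bool) (ws : Vec A r) →
  bit (c xor H (Vec.map v ws)) ≤ bit (c xor H (Vec.map u ws)) + ∑[ w ← Vec.toList ws ] bit (u w xor v w)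
xor-perturb c H u v []       = m≤m+n _ 0
xor-perturb c H u v (w ∷ ws) with u w | v w
... | false | false = xor-perturb c (H ∘ (false ∷_)) u v ws
... | true  | true  = xor-perturb c (H ∘ (true ∷_)) u v ws
... | false | true  = ≤-trans (bit≤1 (c xor _)) (≤-trans (m≤m+n 1 _) (m≤n+m _ _))
... | true  | false = ≤-trans (bit≤1 (c xor _)) (≤-trans (m≤m+n 1 _) (m≤n+m _ _))

-- Sums over triples and functions nearly constant on a box

∑³ : List A → List B → List C → (A → B → C → ℕ) → ℕ
∑³ xs ys zs F = ∑[ x ← xs ] ∑[ y ← ys ] ∑[ z ← zs ] F x y z

∑³-cong : ∀ (xs : List A) (ys : List B) (zs : List C) {F G : A → B → C → ℕ} →
  (∀ x y z → F x y z ≡ G x y z) → ∑³ xs ys zs F ≡ ∑³ xs ys zs G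
∑³-cong xs ys zs eq = ∑-cong xs λ x → ∑-cong ys λ y → ∑-cong zs (eq x y)

∑³-mono : ∀ (xs : List A) (ys : List B) (zs : List C) {F G : A → B → C → ℕ} →
  (∀ x y z → F x y z ≤ G x y z) → ∑³ xs ys zs F ≤ ∑³ xs ys zs G
∑³-mono xs ys zs le = ∑-mono xs λ x → ∑-mono ys λ y → ∑-mono zs (le x y)

∑³-+ : ∀ (xs : List A) (ys : List B) (zs : List C) (F G : A → B → C → ℕ) →
  ∑³ xs ys zs (λ x y z → F x y z + G x y z) ≡ ∑³ xs ys zs F + ∑³ xs ys zs G
∑³-+ xs ys zs F G = trans
  (∑-cong xs λ x → trans (∑-cong ys λ y → ∑-+ zs (F x y) (G x y))
    (∑-+ ys (λ y → ∑ zs (F x y)) (λ y → ∑ zs (G x y))))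
  (∑-+ xs (λ x → ∑[ y ← ys ] ∑ zs (F x y)) (λ x → ∑[ y ← ys ] ∑ zs (G x y)))

∑³-* : ∀ c (xs : List A) (ys : List B) (zs : List C) (F : A → B → C → ℕ) →
  ∑³ xs ys zs (λ x y z → c * F x y z) ≡ c * ∑³ xs ys zs F
∑³-* c xs ys zs F = trans
  (∑-cong xs λ x → trans (∑-cong ys λ y → ∑-* c zs (F x y)) (∑-* c ys (λ y → ∑ zs (F x y))))
  (∑-* c xs (λ x → ∑[ y ← ys ] ∑ zs (F x y)))

∑³-const : ∀ (xs : List A) (ys : List B) (zs : List C) c →
  ∑³ xs ys zs (λ _ _ _ → c) ≡ length xs * length ys * length zs * c
∑³-const xs ys zs c = trans (∑-cong xs λ _ → trans (∑-cong ys λ _ → ∑-const zs c) (∑-const ys (length zs * c)))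
  (trans (∑-const xs (length ys * (length zs * c))) (regroup (length xs) (length ys) (length zs) c))
  where
  regroup : ∀ a b c d → a * (b * (c * d)) ≡ a * b * c * d
  regroup = solve-∀

∑³-swap₁₂ : ∀ (xs : List A) (ys : List B) (zs : List C) (F : A → B → C → ℕ) →
  ∑³ xs ys zs F ≡ ∑³ ys xs zs (λ y x z → F x y z)
∑³-swap₁₂ xs ys zs F = ∑-swap xs ys λ x y → ∑ zs (F x y)

∑³-rotate : ∀ (xs : List A) (ys : List B) (zs : List C) (F : A → B → C → ℕ) →
  ∑³ xs ys zs F ≡ ∑³ ys zs xs (λ y z x → F x y z)
∑³-rotate xs ys zs F = trans (∑-swap xs ys λ x y → ∑ zs (F x y))
  (∑-cong ys λ y → ∑-swap xs zs λ x z → F x y z)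

-- On a box, a function close to one of (y, z), to one of (x, z) and to one of
-- (x, y) is close to a constant: specialising x in the second approximation
-- makes f close to a function of z, and specialising (x, y) in the third one
-- then removes z.
nearlyConstant : ∀ (xs : List A) (ys : List B) (zs : List C) → 0 < length xs → 0 < length ys →
  (f : A → B → C → Bool) (g₁ : B → C → Bool) (g₂ : A → C → Bool) (g₃ : A → B → Bool) →
  ∃[ c ] ∑³ xs ys zs (λ x y z → bit (f x y z xor c)) ≤
         ∑³ xs ys zs (λ x y z → 4 * bit (f x y z xor g₁ y z) + 2 * bit (f x y z xor g₂ x z) + bit (f x y z xor g₃ x y))
nearlyConstant {A} {B} {C} xs ys zs 0<xs 0<ys f g₁ g₂ g₃ = c , (begin
  S (λ x y z → bit (f x y z xor c))
    ≤⟨ detour (λ _ _ z → g z) (λ _ _ _ → c) ⟩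
  S (λ x y z → bit (f x y z xor g z)) + S (λ _ _ z → bit (g z xor c))
    ≤⟨ +-mono-≤ close-g close-c ⟩
  -- The distance from `f` to `g` is paid twice, since `close-c` passes from `g` back through `f` to
  -- reach `g₃`. This gives the coefficients 4, 2 and 1.
  (m₁ + (m₁ + m₂)) + ((m₁ + (m₁ + m₂)) + m₃)
    ≡⟨ collect m₁ m₂ m₃ ⟩
  4 * m₁ + 2 * m₂ + m₃
    ≡⟨ cong₂ (λ a b → a + b + m₃) (∑³-* 4 xs ys zs _) (∑³-* 2 xs ys zs _) ⟨
  S (λ x y z → 4 * bit (f x y z xor g₁ y z)) + S (λ x y z → 2 * bit (f x y z xor g₂ x z)) + m₃
    ≡⟨ cong (_+ m₃) (∑³-+ xs ys zs (λ x y z → 4 * bit (f x y z xor g₁ y z)) (λ x y z → 2 * bit (f x y z xor g₂ x z))) ⟨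
  S (λ x y z → 4 * bit (f x y z xor g₁ y z) + 2 * bit (f x y z xor g₂ x z)) + m₃
    ≡⟨ ∑³-+ xs ys zs (λ x y z → 4 * bit (f x y z xor g₁ y z) + 2 * bit (f x y z xor g₂ x z))
         (λ x y z → bit (f x y z xor g₃ x y)) ⟨
  S (λ x y z → 4 * bit (f x y z xor g₁ y z) + 2 * bit (f x y z xor g₂ x z) + bit (f x y z xor g₃ x y)) ∎)
  where
  open ≤-Reasoning
  S : (A → B → C → ℕ) → ℕ
  S = ∑³ xs ys zs
  m₁ = S λ x y z → bit (f x y z xor g₁ y z)
  m₂ = S λ x y z → bit (f x y z xor g₂ x z)
  m₃ = S λ x y z → bit (f x y z xor g₃ x y)
  collect : ∀ a b c → (a + (a + b)) + ((a + (a + b)) + c) ≡ 4 * a + 2 * b + c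
  collect = solve-∀
  detour : ∀ (u v : A → B → C → Bool) → S (λ x y z → bit (f x y z xor v x y z)) ≤
    S (λ x y z → bit (f x y z xor u x y z)) + S (λ x y z → bit (u x y z xor v x y z))
  detour u v = ≤-trans (∑³-mono xs ys zs λ x y z → xor-triangle (f x y z) (u x y z) (v x y z))
    (≤-reflexive (∑³-+ xs ys zs _ _))
  throughF : ∀ (u v : A → B → C → Bool) → S (λ x y z → bit (u x y z xor v x y z)) ≤
    S (λ x y z → bit (f x y z xor u x y z)) + S (λ x y z → bit (f x y z xor v x y z))
  throughF u v = ≤-trans (∑³-mono xs ys zs λ x y z → xor-triangleʳ (u x y z) (v x y z) (f x y z))
    (≤-reflexive (∑³-+ xs ys zs _ _))

  best-x : ∃[ x ] length xs * (∑[ y ← ys ] ∑[ z ← zs ] bit (g₁ y z xor g₂ x z)) ≤ S (λ x y z → bit (g₁ y z xor g₂ x z))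
  best-x = ∑-min xs _ 0<xs
  g : C → Bool
  g = g₂ (proj₁ best-x)
  close-g : S (λ x y z → bit (f x y z xor g z)) ≤ m₁ + (m₁ + m₂)
  close-g = ≤-trans (detour (λ _ → g₁) (λ _ _ → g)) (+-monoʳ-≤ m₁ (begin
    S (λ _ y z → bit (g₁ y z xor g z))                        ≡⟨ ∑-const xs _ ⟩
    length xs * (∑[ y ← ys ] ∑[ z ← zs ] bit (g₁ y z xor g z)) ≤⟨ proj₂ best-x ⟩
    S (λ x y z → bit (g₁ y z xor g₂ x z))                     ≤⟨ throughF (λ _ → g₁) (λ x _ → g₂ x) ⟩
    m₁ + m₂                                                   ∎))

  best-x′ : ∃[ x ] length xs * (∑[ y ← ys ] ∑[ z ← zs ] bit (g z xor g₃ x y)) ≤ S (λ x y z → bit (g z xor g₃ x y))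
  best-x′ = ∑-min xs _ 0<xs
  x′ = proj₁ best-x′
  best-y : ∃[ y ] length ys * (∑[ z ← zs ] bit (g z xor g₃ x′ y)) ≤ ∑[ y ← ys ] ∑[ z ← zs ] bit (g z xor g₃ x′ y)
  best-y = ∑-min ys _ 0<ys
  c : Bool
  c = g₃ x′ (proj₁ best-y)
  close-c : S (λ _ _ z → bit (g z xor c)) ≤ (m₁ + (m₁ + m₂)) + m₃
  close-c = begin
    S (λ _ _ z → bit (g z xor c))                                ≡⟨ ∑-const xs _ ⟩
    length xs * (∑[ _ ← ys ] ∑[ z ← zs ] bit (g z xor c))         ≡⟨ cong (length xs *_) (∑-const ys _) ⟩
    length xs * (length ys * (∑[ z ← zs ] bit (g z xor c)))       ≤⟨ *-monoʳ-≤ (length xs) (proj₂ best-y) ⟩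
    length xs * (∑[ y ← ys ] ∑[ z ← zs ] bit (g z xor g₃ x′ y))   ≤⟨ proj₂ best-x′ ⟩
    S (λ x y z → bit (g z xor g₃ x y))                           ≤⟨ throughF (λ _ _ → g) (λ x y _ → g₃ x y) ⟩
    S (λ x y z → bit (f x y z xor g z)) + m₃                     ≤⟨ +-monoˡ-≤ m₃ close-g ⟩
    (m₁ + (m₁ + m₂)) + m₃                                        ∎

module _ {V : Set} (vs : List V) (0<vs : 0 < length vs) (k : ℕ) (f : V → V → V → Bool)
         (f-swap₂₃ : ∀ x y z → f x y z ≡ f x z y)
         (¬sh : ∀ y → ¬ RowsShatter (λ x z → f x y z) k) where

  open Traces using (trace)

  -- The error has two sources, each at most the fraction k / suc r of all triples: guessing
  -- `f x y z` from the bits at `zs`, and replacing those `r` bits by guesses from the label. The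
  -- choice of `s` makes `suc s` equal to `suc r * suc r`, so each replaced bit costs only k / (suc
  -- r * suc r) on average.
  labelling : ∀ r → let s = r + r * suc r in
    Σ[ label ∈ (V → Vec (Vec Bool s) r) ] Σ[ h ∈ (V → V → Vec (Vec Bool s) r → Bool) ]
      suc r * ∑³ vs vs vs (λ x y z → bit (f x y z xor h y z (label x)))
        ≤ 2 * (k * (length vs * length vs * length vs))
  labelling r = label , h , (begin
    suc r * ∑³ vs vs vs (λ x y z → bit (f x y z xor h y z (label x)))
      ≡⟨ cong (suc r *_) (∑³-rotate vs vs vs _) ⟩
    suc r * ∑³ vs vs vs (λ y z x → bit (f x y z xor h y z (label x)))
      ≤⟨ *-monoʳ-≤ (suc r) (∑³-mono vs vs vs λ y z x → mistake x y z) ⟩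
    suc r * ∑³ vs vs vs (λ y z x → bit (f x y z xor h₁ y z (trace (λ x z → f x y z) zs x)) +
      ∑ (Vec.toList zs) (λ w → e w y x))
      ≡⟨ cong (suc r *_) (∑³-+ vs vs vs _ _) ⟩
    suc r * (S₁ + ∑³ vs vs vs (λ y z x → ∑ (Vec.toList zs) (λ w → e w y x)))
      ≡⟨ *-distribˡ-+ (suc r) S₁ _ ⟩
    suc r * S₁ + suc r * ∑³ vs vs vs (λ y z x → ∑ (Vec.toList zs) (λ w → e w y x))
      ≤⟨ +-mono-≤ zs-good inner ⟩
    n * (k * n * n) + n * (k * n * n)
      ≡⟨ collect k n ⟩
    2 * (k * (n * n * n)) ∎)
    where
    open ≤-Reasoning
    n s : ℕ
    n = length vs
    s = r + r * suc r
    -- The index of the family is `y`, so one tuple `zs` serves all `y` and the label of `x` need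
    -- not know `y`.
    sample = commonSample (λ y x z → f x y z) k r vs vs vs 0<vs ¬sh
    zs : Vec V r
    zs = proj₁ sample
    h₁ : V → V → Vec Bool r → Bool
    h₁ = proj₁ (proj₂ sample)
    S₁ = ∑³ vs vs vs λ y z x → bit (f x y z xor h₁ y z (trace (λ x z → f x y z) zs x))
    zs-good : suc r * S₁ ≤ n * (k * n * n)
    zs-good = proj₂ (proj₂ sample)
    -- A family with one member: inside the slice at `w`, sampled columns are to predict `f x w y`
    -- for varying `y`.
    sampleAt = λ w → commonSample {I = ⊤} (λ _ x y → f x w y) k s (tt ∷ []) vs vs 0<vs (λ _ → ¬sh w)
    traceAt : V → V → Vec Bool s
    traceAt w = trace (λ x y → f x w y) (proj₁ (sampleAt w))
    h₂ : V → V → Vec Bool s → Bool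
    h₂ w y = proj₁ (proj₂ (sampleAt w)) tt y
    e : V → V → V → ℕ
    e w y x = bit (f x w y xor h₂ w y (traceAt w x))
    label : V → Vec (Vec Bool s) r
    label x = Vec.map (λ w → traceAt w x) zs
    h : V → V → Vec (Vec Bool s) r → Bool
    h y z L = h₁ y z (Vec.zipWith (λ w → h₂ w y) zs L)

    zipWith-label : ∀ {m} y x (ws : Vec V m) →
      Vec.zipWith (λ w → h₂ w y) ws (Vec.map (λ w → traceAt w x) ws) ≡ Vec.map (λ w → h₂ w y (traceAt w x)) ws
    zipWith-label y x []       = refl
    zipWith-label y x (w ∷ ws) = cong (_ ∷_) (zipWith-label y x ws)

    mistake : ∀ x y z → bit (f x y z xor h y z (label x)) ≤
      bit (f x y z xor h₁ y z (trace (λ x z → f x y z) zs x)) + ∑ (Vec.toList zs) (λ w → e w y x)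
    mistake x y z = begin
      bit (f x y z xor h y z (label x))
        ≡⟨ cong (λ t → bit (f x y z xor h₁ y z t)) (zipWith-label y x zs) ⟩
      bit (f x y z xor h₁ y z (Vec.map (λ w → h₂ w y (traceAt w x)) zs))
        ≤⟨ xor-perturb (f x y z) (h₁ y z) (f x y) (λ w → h₂ w y (traceAt w x)) zs ⟩
      bit (f x y z xor h₁ y z (Vec.map (f x y) zs)) + ∑[ w ← Vec.toList zs ] bit (f x y w xor h₂ w y (traceAt w x))
        ≡⟨ cong (bit (f x y z xor h₁ y z (Vec.map (f x y) zs)) +_)
             (∑-cong (Vec.toList zs) λ w → cong (λ b → bit (b xor h₂ w y (traceAt w x))) (f-swap₂₃ x y w)) ⟩
      bit (f x y z xor h₁ y z (Vec.map (f x y) zs)) + ∑ (Vec.toList zs) (λ w → e w y x) ∎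

    E : V → ℕ
    E w = ∑[ y ← vs ] ∑[ x ← vs ] e w y x

    E-small : ∀ w → suc r * (suc r * E w) ≤ k * n * n
    E-small w = begin
      suc r * (suc r * E w)       ≡⟨ *-assoc (suc r) (suc r) (E w) ⟨
      suc s * E w                 ≡⟨ cong (suc s *_) (+-identityʳ (E w)) ⟨
      suc s * (E w + 0)           ≤⟨ proj₂ (proj₂ (sampleAt w)) ⟩
      1 * (k * n * n)             ≡⟨ *-identityˡ (k * n * n) ⟩
      k * n * n                   ∎

    ∑E-small : suc r * ∑ (Vec.toList zs) E ≤ k * n * n
    ∑E-small = *-cancelˡ-≤ (suc r) (begin
      suc r * (suc r * ∑ (Vec.toList zs) E)            ≡⟨ cong (suc r *_) (∑-* (suc r) (Vec.toList zs) E) ⟨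
      suc r * (∑[ w ← Vec.toList zs ] (suc r * E w))   ≡⟨ ∑-* (suc r) (Vec.toList zs) _ ⟨
      ∑[ w ← Vec.toList zs ] (suc r * (suc r * E w))   ≤⟨ ∑-mono (Vec.toList zs) E-small ⟩
      ∑[ _ ← Vec.toList zs ] (k * n * n)               ≡⟨ ∑-const (Vec.toList zs) _ ⟩
      length (Vec.toList zs) * (k * n * n)             ≡⟨ cong (_* (k * n * n)) (length-toList zs) ⟩
      -- Rounding `r` up to `suc r` lets one of the two factors `suc r` cancel.
      r * (k * n * n)                                  ≤⟨ *-monoˡ-≤ (k * n * n) (n≤1+n r) ⟩
      suc r * (k * n * n)                              ∎)

    inner : suc r * ∑³ vs vs vs (λ y z x → ∑ (Vec.toList zs) (λ w → e w y x)) ≤ n * (k * n * n)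
    inner = begin
      suc r * ∑³ vs vs vs (λ y z x → ∑ (Vec.toList zs) (λ w → e w y x))
        ≡⟨ cong (suc r *_) (∑³-swap₁₂ vs vs vs _) ⟩
      suc r * ∑³ vs vs vs (λ z y x → ∑ (Vec.toList zs) (λ w → e w y x))
        ≡⟨ cong (suc r *_) (∑-const vs _) ⟩
      suc r * (n * (∑[ y ← vs ] ∑[ x ← vs ] ∑ (Vec.toList zs) (λ w → e w y x)))
        ≡⟨ cong (λ a → suc r * (n * a)) (∑³-rotate (Vec.toList zs) vs vs e) ⟨
      suc r * (n * ∑ (Vec.toList zs) E)
        ≡⟨ commute (suc r) n _ ⟩
      n * (suc r * ∑ (Vec.toList zs) E)
        ≤⟨ *-monoʳ-≤ n ∑E-small ⟩
      n * (k * n * n) ∎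
      where
      commute : ∀ a b c → a * (b * c) ≡ b * (a * c)
      commute = solve-∀

    collect : ∀ k n → n * (k * n * n) + n * (k * n * n) ≡ 2 * (k * (n * n * n))
    collect = solve-∀

-- Numbering the labels

Surjective : ∀ {n N} → (Fin n → Fin N) → Set
Surjective φ = ∀ i → ∃[ x ] φ x ≡ i

-- Missed values are punched out one at a time until none is left, so that every class is nonempty,
-- as `Partition` demands. `ι` recovers the original value, from which the label is decoded.
restrictToImage : ∀ {n M} (φ : Fin n → Fin M) → ∃[ N ] N ≤ M × Σ[ ψ ∈ (Fin n → Fin N) ] Σ[ ι ∈ (Fin N → Fin M) ]
  Surjective ψ × (∀ x → ι (ψ x) ≡ φ x)
restrictToImage {n} {M} φ with Fin.all? (λ i → Fin.any? (λ x → φ x Fin.≟ i))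
... | yes onto = M , ≤-refl , φ , (λ i → i) , onto , λ _ → refl
restrictToImage {n} {zero}  φ | no ¬onto = ⊥-elim (¬onto λ ())
restrictToImage {n} {suc M} φ | no ¬onto
  with i , missed ← Fin.¬∀⟶∃¬ (suc M) _ (λ i → Fin.any? (λ x → φ x Fin.≟ i)) ¬onto
  with N , N≤M , ψ , ι , onto , eq ←
    restrictToImage (λ x → punchOut {i = i} {j = φ x} λ i≡φx → missed (x , sym i≡φx)) =
  N , m≤n⇒m≤1+n N≤M , ψ , punchIn i ∘ ι , onto ,
  λ x → trans (cong (punchIn i) (eq x)) (Fin.punchIn-punchOut λ i≡φx → missed (x , sym i≡φx))

module _ {r s : ℕ} where
  encode : Vec (Vec Bool s) r → Fin ((2 ^ s) ^ r)
  encode L = funToFin λ i → funToFin λ j → Inverse.from Fin.2↔Bool (lookup (lookup L i) j)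

  decode : Fin ((2 ^ s) ^ r) → Vec (Vec Bool s) r
  decode c = Vec.tabulate λ i → Vec.tabulate λ j → Inverse.to Fin.2↔Bool (finToFun {2} {s} (finToFun {2 ^ s} {r} c i) j)

  decode-encode : ∀ L → decode (encode L) ≡ L
  decode-encode L = trans
    (tabulate-cong λ i → trans (tabulate-cong λ j → bit-of i j) (tabulate∘lookup (lookup L i))) (tabulate∘lookup L)
    where
    bit-of : ∀ i j → Inverse.to Fin.2↔Bool (finToFun {2} {s} (finToFun {2 ^ s} {r} (encode L) i) j) ≡ lookup (lookup L i) j
    bit-of i j = trans
      (cong (λ c → Inverse.to Fin.2↔Bool (finToFun c j))
        (Fin.finToFun-funToFin (λ i → funToFin λ j → Inverse.from Fin.2↔Bool (lookup (lookup L i) j)) i))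
      (trans (cong (Inverse.to Fin.2↔Bool)
          (Fin.finToFun-funToFin (λ j → Inverse.from Fin.2↔Bool (lookup (lookup L i) j)) j))
        (Inverse.inverseˡ Fin.2↔Bool refl))

-- Boxes of label classes

does≡true⇒ : ∀ {A : Set} (a? : Dec A) → does a? ≡ true → A
does≡true⇒ (yes a) _ = a

∑-tabulate : ∀ {A : Set} {n} (g : Fin n → A) f → ∑ (tabulate g) f ≡ ∑ (allFin n) (f ∘ g)
∑-tabulate g f = trans (cong (λ xs → ∑ xs f) (sym (map-tabulate id g))) (∑-map g (allFin _) f)

∑-indicator : ∀ {N} (i : Fin N) c → ∑[ j ← allFin N ] (bit (does (i Fin.≟ j)) * c) ≡ c
∑-indicator {suc N} zero c = begin
  1 * c + ∑ (tabulate {n = N} Fin.suc) (λ j → bit (does (zero Fin.≟ j)) * c)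
    ≡⟨ cong (1 * c +_) (∑-tabulate {n = N} Fin.suc _) ⟩
  1 * c + ∑ (allFin N) (const 0)
    ≡⟨ cong (1 * c +_) (trans (∑-const (allFin N) 0) (*-zeroʳ (length (allFin N)))) ⟩
  1 * c + 0
    ≡⟨ trans (+-identityʳ (1 * c)) (*-identityˡ c) ⟩
  c ∎
  where open ≡-Reasoning
∑-indicator {suc N} (suc i) c = trans (∑-tabulate {n = N} Fin.suc _) (∑-indicator i c)

module Blocks {V : Set} (vs : List V) {N : ℕ} (φ : V → Fin N) where

  block : Fin N → List V
  block i = filter (λ v → φ v Fin.≟ i) vs

  ∑-blocks : ∀ F → ∑ vs F ≡ ∑[ i ← allFin N ] ∑ (block i) F
  ∑-blocks F = begin
    ∑ vs F                                                        ≡⟨ ∑-cong vs (λ v → ∑-indicator (φ v) (F v)) ⟨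
    ∑[ v ← vs ] ∑[ i ← allFin N ] (bit (does (φ v Fin.≟ i)) * F v) ≡⟨ ∑-swap vs (allFin N) _ ⟩
    ∑[ i ← allFin N ] ∑[ v ← vs ] (bit (does (φ v Fin.≟ i)) * F v) ≡⟨ ∑-cong (allFin N) (λ i → ∑-filter (λ v → φ v Fin.≟ i) vs F) ⟨
    ∑[ i ← allFin N ] ∑ (block i) F                               ∎
    where open ≡-Reasoning

  box : (V → V → V → ℕ) → Fin N → Fin N → Fin N → ℕ
  box F i j l = ∑³ (block i) (block j) (block l) F

  volume : Fin N → Fin N → Fin N → ℕ
  volume i j l = length (block i) * length (block j) * length (block l)

  ∑³-blocks : ∀ F → ∑³ vs vs vs F ≡ ∑³ (allFin N) (allFin N) (allFin N) (box F)
  ∑³-blocks F = begin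
    ∑[ x ← vs ] ∑[ y ← vs ] ∑ vs (F x y)
      ≡⟨ ∑-blocks _ ⟩
    ∑[ i ← allFin N ] ∑[ x ← block i ] ∑[ y ← vs ] ∑ vs (F x y)
      ≡⟨ ∑-cong (allFin N) (λ i → trans
           (∑-cong (block i) λ x → trans (∑-blocks _) (∑-cong (allFin N) λ j → ∑-cong (block j) λ y → ∑-blocks (F x y)))
           (∑-swap (block i) (allFin N) _)) ⟩
    ∑[ i ← allFin N ] ∑[ j ← allFin N ] ∑[ x ← block i ] ∑[ y ← block j ] ∑[ l ← allFin N ] ∑ (block l) (F x y)
      ≡⟨ ∑-cong (allFin N) (λ i → ∑-cong (allFin N) λ j → trans
           (∑-cong (block i) λ x → ∑-swap (block j) (allFin N) _) (∑-swap (block i) (allFin N) _)) ⟩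
    ∑³ (allFin N) (allFin N) (allFin N) (box F) ∎
    where open ≡-Reasoning

  box-cong : ∀ i j l {F G : V → V → V → ℕ} → (∀ {x y z} → φ x ≡ i → φ y ≡ j → φ z ≡ l → F x y z ≡ G x y z) →
             box F i j l ≡ box G i j l
  box-cong i j l eq = ∑-filter-cong _ vs λ x∈ → ∑-filter-cong _ vs λ y∈ → ∑-filter-cong _ vs λ z∈ → eq x∈ y∈ z∈

  box-const : ∀ i j l c → box (λ _ _ _ → c) i j l ≡ volume i j l * c
  box-const i j l c = ∑³-const (block i) (block j) (block l) c

  module _ (f : V → V → V → Bool) where

    mistakes : Bool → Fin N → Fin N → Fin N → ℕ
    mistakes c = box λ x y z → bit (f x y z xor c)

    -- The share of mistakes exceeds 1 / m, stated without division. The comparison is strict, so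
    -- that its negation is the bound that `homogeneous` takes.
    Bad : ℕ → (Fin N → Fin N → Fin N → Bool) → Fin N → Fin N → Fin N → Bool
    Bad m c i j l = does (volume i j l <? m * mistakes (c i j l) i j l)

    #bad : ℕ → (Fin N → Fin N → Fin N → Bool) → ℕ
    #bad m c = ∑³ vs vs vs λ x y z → bit (Bad m c (φ x) (φ y) (φ z))

    -- Markov's inequality box by box: the volume of a bad box is less than `m` times its mistakes.
    #bad-bound : ∀ m c → #bad m c ≤ m * ∑³ (allFin N) (allFin N) (allFin N) (λ i j l → mistakes (c i j l) i j l)
    #bad-bound m c = begin
      #bad m c
        ≡⟨ ∑³-blocks _ ⟩
      ∑³ (allFin N) (allFin N) (allFin N) (box λ x y z → bit (Bad m c (φ x) (φ y) (φ z)))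
        ≡⟨ ∑³-cong (allFin N) (allFin N) (allFin N) (λ i j l → trans
             (box-cong i j l λ { refl refl refl → refl }) (box-const i j l (bit (Bad m c i j l)))) ⟩
      ∑³ (allFin N) (allFin N) (allFin N) (λ i j l → volume i j l * bit (Bad m c i j l))
        ≤⟨ ∑³-mono (allFin N) (allFin N) (allFin N) (λ i j l → markov (volume i j l) (m * mistakes (c i j l) i j l)) ⟩
      ∑³ (allFin N) (allFin N) (allFin N) (λ i j l → m * mistakes (c i j l) i j l)
        ≡⟨ ∑³-* m (allFin N) (allFin N) (allFin N) _ ⟩
      m * ∑³ (allFin N) (allFin N) (allFin N) (λ i j l → mistakes (c i j l) i j l) ∎
      where
      open ≤-Reasoning
      markov : ∀ a b → a * bit (does (a <? b)) ≤ b
      markov a b with a <ᵇ b in eq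
      ... | true  = ≤-trans (≤-reflexive (*-identityʳ a)) (<⇒≤ (does≡true⇒ (a <? b) eq))
      ... | false = ≤-trans (≤-reflexive (*-zeroʳ a)) z≤n

    predictionError : (V → V → Fin N → Bool) → ℕ
    predictionError h = ∑³ vs vs vs λ x y z → bit (f x y z xor h y z (φ x))

    module _ (f-swap₁₂ : ∀ x y z → f x y z ≡ f y x z) (f-swap₂₃ : ∀ x y z → f x y z ≡ f x z y)
             (nonempty : ∀ i → 0 < length (block i)) (h : V → V → Fin N → Bool) where

      -- The errors weighted 4, 2 and 1 by `nearlyConstant` are summed over all boxes. By the
      -- symmetry of `f`, predicting from the label of `y` or of `z` errs as often as from that of
      -- `x`, which gives 7 times one error.
      nearlyConstantBoxes : Σ[ c ∈ (Fin N → Fin N → Fin N → Bool) ]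
        ∑³ (allFin N) (allFin N) (allFin N) (λ i j l → mistakes (c i j l) i j l) ≤ 7 * predictionError h
      nearlyConstantBoxes = c , (begin
        ∑³ (allFin N) (allFin N) (allFin N) (λ i j l → mistakes (c i j l) i j l)
          ≤⟨ ∑³-mono (allFin N) (allFin N) (allFin N) (λ i j l → ≤-trans
               (proj₂ (near i j l)) (≤-reflexive (box-cong i j l λ { refl refl refl → refl }))) ⟩
        ∑³ (allFin N) (allFin N) (allFin N) (box D)
          ≡⟨ ∑³-blocks D ⟨
        ∑³ vs vs vs D
          ≡⟨ trans (∑³-+ vs vs vs (λ x y z → 4 * D₁ x y z + 2 * D₂ x y z) D₃)
               (cong (_+ ∑³ vs vs vs D₃) (∑³-+ vs vs vs (λ x y z → 4 * D₁ x y z) (λ x y z → 2 * D₂ x y z))) ⟩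
        ∑³ vs vs vs (λ x y z → 4 * D₁ x y z) + ∑³ vs vs vs (λ x y z → 2 * D₂ x y z) + ∑³ vs vs vs D₃
          ≡⟨ cong₂ (λ a b → a + b + ∑³ vs vs vs D₃) (∑³-* 4 vs vs vs D₁) (trans (∑³-* 2 vs vs vs D₂) (cong (2 *_) D₂-total)) ⟩
        4 * err + 2 * err + ∑³ vs vs vs D₃
          ≡⟨ cong (4 * err + 2 * err +_) D₃-total ⟩
        4 * err + 2 * err + err
          ≡⟨ collect err ⟩
        7 * err ∎)
        where
        open ≤-Reasoning
        err : ℕ
        err = predictionError h
        -- Inside a box the label is fixed, so a prediction from the label of one vertex is a
        -- function of the other two vertices.
        near = λ i j l → nearlyConstant (block i) (block j) (block l) (nonempty i) (nonempty j) f
          (λ y z → h y z i) (λ x z → h x z j) (λ x y → h x y l)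
        c = λ i j l → proj₁ (near i j l)
        D₁ D₂ D₃ D : V → V → V → ℕ
        D₁ x y z = bit (f x y z xor h y z (φ x))
        D₂ x y z = bit (f x y z xor h x z (φ y))
        D₃ x y z = bit (f x y z xor h x y (φ z))
        D x y z = 4 * D₁ x y z + 2 * D₂ x y z + D₃ x y z
        D₂-total : ∑³ vs vs vs D₂ ≡ err
        D₂-total = trans (∑³-cong vs vs vs λ x y z → cong (λ b → bit (b xor h x z (φ y))) (f-swap₁₂ x y z))
          (∑³-swap₁₂ vs vs vs (λ x y z → bit (f y x z xor h x z (φ y))))
        D₃-total : ∑³ vs vs vs D₃ ≡ err
        D₃-total = trans (∑³-cong vs vs vs λ x y z → cong (λ b → bit (b xor h x y (φ z))) (trans (f-swap₂₃ x y z) (f-swap₁₂ x z y)))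
          (sym (∑³-rotate vs vs vs D₁))
        collect : ∀ a → 4 * a + 2 * a + a ≡ 7 * a
        collect = solve-∀

-- The factor 7 comes from nearlyConstantBoxes, the factor 2 k from labelling,
-- and m enters once through #bad-bound and once through the target n ^ 3 / m.
scale : ℕ → ℕ → ℕ
scale k m = 14 * k * (m * m)

homogeneousBoxes : ∀ k m n .{{_ : NonZero k}} .{{_ : NonZero m}} → 0 < n → (f : Fin n → Fin n → Fin n → Bool) →
  (∀ x y z → f x y z ≡ f y x z) → (∀ x y z → f x y z ≡ f x z y) → (∀ y → ¬ RowsShatter (λ x z → f x y z) k) →
  ∃[ N ] N ≤ 2 ^ (scale k m ^ 3) × Σ[ φ ∈ (Fin n → Fin N) ] Surjective φ ×
    Σ[ c ∈ (Fin N → Fin N → Fin N → Bool) ] m * Blocks.#bad (allFin n) φ f m c ≤ n ^ 3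
homogeneousBoxes k m n 0<n f f-swap₁₂ f-swap₂₃ ¬sh = N , N-small , φ , φ-onto , c , *-cancelˡ-≤ (2 * k) (begin
  2 * k * (m * #bad f m c)
    ≤⟨ *-monoʳ-≤ (2 * k) (*-monoʳ-≤ m (≤-trans (#bad-bound f m c) (*-monoʳ-≤ m (proj₂ good)))) ⟩
  2 * k * (m * (m * (7 * err)))
    ≡⟨ regroup k m err ⟩
  scale k m * err
    ≡⟨ cong (_* err) R≡ ⟨
  suc r * err
    ≡⟨ cong (suc r *_) (∑³-cong V V V λ x y z → cong (λ L → bit (f x y z xor h y z L))
         (trans (cong (decode {r} {s}) (ι∘φ x)) (decode-encode {r} {s} (label x)))) ⟩
  suc r * ∑³ V V V (λ x y z → bit (f x y z xor h y z (label x)))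
    ≤⟨ proj₂ (proj₂ labels) ⟩
  2 * (k * (length V * length V * length V))
    ≡⟨ cong (λ a → 2 * (k * (a * a * a))) (length-tabulate {n = n} id) ⟩
  2 * (k * (n * n * n))
    ≡⟨ cube k n ⟩
  2 * k * n ^ 3 ∎)
  where
  open ≤-Reasoning
  V = allFin n
  r s : ℕ
  -- `labelling` gains the factor `suc r`, which is thus exactly `scale k m`.
  r = pred (scale k m)
  s = r + r * suc r
  instance
    _ : NonZero (14 * k)
    _ = m*n≢0 14 k
    _ : NonZero (2 * k)
    _ = m*n≢0 2 k
    _ : NonZero (m * m)
    _ = m*n≢0 m m
  R≡ : suc r ≡ scale k m
  R≡ = suc-pred (scale k m) {{m*n≢0 (14 * k) (m * m)}}
  labels = labelling V (subst (0 <_) (sym (length-tabulate {n = n} id)) 0<n) k f f-swap₂₃ ¬sh r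
  label = proj₁ labels
  h = proj₁ (proj₂ labels)
  image = restrictToImage (encode {r} {s} ∘ label)
  N : ℕ
  N = proj₁ image
  φ = proj₁ (proj₂ (proj₂ image))
  ι = proj₁ (proj₂ (proj₂ (proj₂ image)))
  φ-onto = proj₁ (proj₂ (proj₂ (proj₂ (proj₂ image))))
  ι∘φ = proj₂ (proj₂ (proj₂ (proj₂ (proj₂ image))))
  open Blocks V φ
  block-nonempty : ∀ i → 0 < length (block i)
  block-nonempty i with x , φx≡i ← φ-onto i = ∈-length (∈-filter⁺ (λ v → φ v Fin.≟ i) (∈-allFin x) φx≡i)
  h′ : Fin n → Fin n → Fin N → Bool
  h′ y z i = h y z (decode {r} {s} (ι i))
  err = predictionError f h′
  good = nearlyConstantBoxes f f-swap₁₂ f-swap₂₃ block-nonempty h′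
  c = proj₁ good
  N-small : N ≤ 2 ^ (scale k m ^ 3)
  N-small = begin
    N                          ≤⟨ proj₁ (proj₂ image) ⟩
    (2 ^ s) ^ r                ≡⟨ ^-*-assoc 2 s r ⟩
    -- Since `suc s` is `suc r * suc r`, the exponent is at most the cube of `suc r`.
    2 ^ (s * r)                ≤⟨ ^-monoʳ-≤ 2 (*-mono-≤ (n≤1+n s) (n≤1+n r)) ⟩
    2 ^ (suc r * suc r * suc r) ≡⟨ cong (2 ^_) (trans (cong (λ a → a * a * a) R≡) (cube′ (scale k m))) ⟩
    2 ^ (scale k m ^ 3)        ∎
    where
    cube′ : ∀ a → a * a * a ≡ a * (a * (a * 1))
    cube′ = solve-∀
  regroup : ∀ k m e → 2 * k * (m * (m * (7 * e))) ≡ 14 * k * (m * m) * e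
  regroup = solve-∀
  cube : ∀ k n → 2 * (k * (n * n * n)) ≡ 2 * k * (n * (n * (n * 1)))
  cube = solve-∀

-- Hypergraphs of small slicewise VC-dimension

does≡false⇒ : ∀ {A : Set} (a? : Dec A) → does a? ≡ false → ¬ A
does≡false⇒ (no ¬a) _ = ¬a

∣p∪q∣≤∣p∣+∣q∣ : ∀ {n} (p q : Subset n) → ∣ p ∪ q ∣ ≤ ∣ p ∣ + ∣ q ∣
∣p∪q∣≤∣p∣+∣q∣ []          []          = z≤n
∣p∪q∣≤∣p∣+∣q∣ (false ∷ p) (false ∷ q) = ∣p∪q∣≤∣p∣+∣q∣ p q
∣p∪q∣≤∣p∣+∣q∣ (false ∷ p) (true  ∷ q) = ≤-trans (s≤s (∣p∪q∣≤∣p∣+∣q∣ p q)) (≤-reflexive (sym (+-suc ∣ p ∣ ∣ q ∣)))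
∣p∪q∣≤∣p∣+∣q∣ (true  ∷ p) (false ∷ q) = s≤s (∣p∪q∣≤∣p∣+∣q∣ p q)
∣p∪q∣≤∣p∣+∣q∣ (true  ∷ p) (true  ∷ q) = s≤s (≤-trans (∣p∪q∣≤∣p∣+∣q∣ p q) (+-monoʳ-≤ ∣ p ∣ (n≤1+n ∣ q ∣)))

∣⁅x⁆∪⁅y⁆∣≤2 : ∀ {n} (x y : Fin n) → ∣ ⁅ x ⁆ ∪ ⁅ y ⁆ ∣ ≤ 2
∣⁅x⁆∪⁅y⁆∣≤2 x y = subst₂ (λ a b → ∣ ⁅ x ⁆ ∪ ⁅ y ⁆ ∣ ≤ a + b) (∣⁅x⁆∣≡1 x) (∣⁅x⁆∣≡1 y) (∣p∪q∣≤∣p∣+∣q∣ ⁅ x ⁆ ⁅ y ⁆)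

-- `P` need not be decidable, so whether `l` is already greatest cannot be tested. Under the
-- assumption that there is no greatest element above `l`, a larger element of `P` is refuted by
-- recursion, whose depth `d` is limited by the distance to `B`; hence `l` would itself be greatest.
greatest-¬¬exists : ∀ {P : ℕ → Set} {B} → (∀ {l} → P l → l ≤ B) → ∀ {l} → P l → ¬ ¬ (∃[ m ] Greatest P m × l ≤ m)
greatest-¬¬exists {P} {B} bound {l} Pl = go B l (m≤m+n B l) Pl
  where
  go : ∀ d l → B ≤ d + l → P l → ¬ ¬ (∃[ m ] Greatest P m × l ≤ m)
  go zero    l B≤l Pl none = none (l , (Pl , λ Pl′ → ≤-trans (bound Pl′) B≤l) , ≤-refl)
  go (suc d) l B≤  Pl none = none (l , (Pl , greatest) , ≤-refl)
    where
    greatest : ∀ {l′} → P l′ → l′ ≤ l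
    greatest {l′} Pl′ with l′ ≤? l
    ... | yes l′≤l = l′≤l
    ... | no  l′≰l = ⊥-elim (go d l′
      (≤-trans B≤ (≤-trans (≤-reflexive (sym (+-suc d l))) (+-monoʳ-≤ d (≰⇒> l′≰l)))) Pl′
      λ (m , Pm , l′≤m) → none (m , Pm , ≤-trans (<⇒≤ (≰⇒> l′≰l)) l′≤m))

-- The vertex `b ⁅ i ⁆` is adjacent to `a i` and to no `a j` with another index, so `a` is
-- injective.
shatters⇒≤ : ∀ {n m} (G : Graph n) → Shatters G m → m ≤ n
shatters⇒≤ G (a , b , adj) = Fin.injective⇒≤ {f = a} λ {i} {j} ai≡aj → sym (x∈⁅y⁆⇒x≡y i
  (to (adj j ⁅ i ⁆) (subst (λ v → Edge G (⁅ v ⁆ ∪ ⁅ b ⁅ i ⁆ ⁆)) ai≡aj (from (adj i ⁅ i ⁆) (x∈⁅x⁆ i)))))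

-- `SVC` speaks only of slices with a given VC-dimension. A shattered `k`-set yields such a
-- dimension, at least `k`, up to double negation, which is enough for a contradiction.
SVC<⇒¬shatters : ∀ {n s k} (H : 3-Graph n) → SVC H s → s < k → ∀ x → ¬ Shatters (slice H x) k
SVC<⇒¬shatters H (_ , s-greatest) s<k x sh = greatest-¬¬exists (shatters⇒≤ (slice H x)) sh
  λ (m , vc , k≤m) → <-irrefl refl (<-≤-trans s<k (≤-trans k≤m (s-greatest (x , vc))))

module _ {n : ℕ} (H : 3-Graph n) where

  edgeBit : Fin n → Fin n → Fin n → Bool
  edgeBit x y z = does (edge? H (⁅ x ⁆ ∪ ⁅ y ⁆ ∪ ⁅ z ⁆))

  edgeBit-swap₂₃ : ∀ x y z → edgeBit x y z ≡ edgeBit x z y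
  edgeBit-swap₂₃ x y z = cong (λ e → does (edge? H (⁅ x ⁆ ∪ e))) (∪-comm ⁅ y ⁆ ⁅ z ⁆)

  edgeBit-swap₁₂ : ∀ x y z → edgeBit x y z ≡ edgeBit y x z
  edgeBit-swap₁₂ x y z = cong (λ e → does (edge? H e))
    (trans (sym (∪-assoc ⁅ x ⁆ ⁅ y ⁆ ⁅ z ⁆)) (trans (cong (_∪ ⁅ z ⁆) (∪-comm ⁅ x ⁆ ⁅ y ⁆)) (∪-assoc ⁅ y ⁆ ⁅ x ⁆ ⁅ z ⁆)))

  rowsShatter⇒shatters : ∀ {k} y → RowsShatter (λ x z → edgeBit x y z) k → Shatters (slice H y) k
  rowsShatter⇒shatters y (a , realise) = a , proj₁ ∘ realise , λ i S → mk⇔ (adj⇒∈ i S) (∈⇒adj i S)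
    where
    b = proj₁ ∘ realise
    rotated : ∀ i S → ⁅ b S ⁆ ∪ ⁅ y ⁆ ∪ ⁅ a i ⁆ ≡ ⁅ y ⁆ ∪ ⁅ a i ⁆ ∪ ⁅ b S ⁆
    rotated i S = trans (∪-comm ⁅ b S ⁆ (⁅ y ⁆ ∪ ⁅ a i ⁆)) (∪-assoc ⁅ y ⁆ ⁅ a i ⁆ ⁅ b S ⁆)
    adj⇒∈ : ∀ i S → Edge (slice H y) (⁅ a i ⁆ ∪ ⁅ b S ⁆) → i ∈ˢ S
    adj⇒∈ i S (_ , e) = lookup⇒[]= i S
      (trans (sym (proj₂ (realise S) i)) (dec-true (edge? H _) (subst (Edge H) (sym (rotated i S)) e)))
    ∈⇒adj : ∀ i S → i ∈ˢ S → Edge (slice H y) (⁅ a i ⁆ ∪ ⁅ b S ⁆)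
    ∈⇒adj i S i∈S = ≤-antisym (∣⁅x⁆∪⁅y⁆∣≤2 (a i) (b S)) (s≤s⁻¹ 3≤) , e
      where
      e : Edge H (⁅ y ⁆ ∪ ⁅ a i ⁆ ∪ ⁅ b S ⁆)
      e = subst (Edge H) (rotated i S) (does≡true⇒ (edge? H _) (trans (proj₂ (realise S) i) ([]=⇒lookup i∈S)))
      -- `slice` asks for a pair of two distinct vertices: the edge has three elements, and `y`
      -- supplies at most one of them.
      3≤ : 3 ≤ suc ∣ ⁅ a i ⁆ ∪ ⁅ b S ⁆ ∣
      3≤ = subst₂ (λ u v → u ≤ v + ∣ ⁅ a i ⁆ ∪ ⁅ b S ⁆ ∣) (uniform H e) (∣⁅x⁆∣≡1 y)
        (∣p∪q∣≤∣p∣+∣q∣ ⁅ y ⁆ (⁅ a i ⁆ ∪ ⁅ b S ⁆))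

-- Label classes as a homogeneous partition

module _ {n N : ℕ} (φ : Fin n → Fin N) where

  fibre : Fin N → Subset n
  fibre i = Vec.tabulate λ v → does (φ v Fin.≟ i)

  ∈-fibre⁺ : ∀ {v i} → φ v ≡ i → v ∈ˢ fibre i
  ∈-fibre⁺ {v} {i} eq = lookup⇒[]= v (fibre i) (trans (lookup∘tabulate _ v) (dec-true (φ v Fin.≟ i) eq))

  ∈-fibre⁻ : ∀ {v i} → v ∈ˢ fibre i → φ v ≡ i
  ∈-fibre⁻ {v} {i} v∈ = does≡true⇒ (φ v Fin.≟ i) (trans (sym (lookup∘tabulate _ v)) ([]=⇒lookup v∈))

  fibres : Surjective φ → Partition n N
  fibres onto = record
    { part     = fibre
    ; nonempty = λ i → proj₁ (onto i) , ∈-fibre⁺ (proj₂ (onto i))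
    ; cover    = λ v → φ v , ∈-fibre⁺ refl
    ; disjoint = λ v∈i v∈j → trans (sym (∈-fibre⁻ v∈i)) (∈-fibre⁻ v∈j)
    }

  open Blocks (allFin n) φ

  ∣fibre∣ : ∀ i → ∣ fibre i ∣ ≡ length (block i)
  ∣fibre∣ i = trans (∣tabulate∣ λ v → does (φ v Fin.≟ i)) (sym (length-filter-∑ (λ v → φ v Fin.≟ i) (allFin n)))
    where
    ∣tabulate∣ : ∀ {m} (g : Fin m → Bool) → ∣ Vec.tabulate g ∣ ≡ ∑ (allFin m) (bit ∘ g)
    ∣tabulate∣ {zero}  g = refl
    ∣tabulate∣ {suc m} g with g zero
    ... | false = trans (∣tabulate∣ (g ∘ suc)) (sym (∑-tabulate {n = m} Fin.suc (bit ∘ g)))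
    ... | true  = cong suc (trans (∣tabulate∣ (g ∘ suc)) (sym (∑-tabulate {n = m} Fin.suc (bit ∘ g))))

  module _ (H : 3-Graph n) where

    -- The membership tests become 0-1 factors; each is pulled out of the inner sums and absorbed by
    -- restricting one sum to its block.
    #edges≡box : ∀ i j l → #edges H (fibre i) (fibre j) (fibre l) ≡ box (λ x y z → bit (edgeBit H x y z)) i j l
    #edges≡box i j l = begin
      #edges H (fibre i) (fibre j) (fibre l)
        ≡⟨ length-filter-∑ _ (cartesianProduct V (cartesianProduct V V)) ⟩
      _
        ≡⟨ ∑-cartesianProduct V (cartesianProduct V V) _ ⟩
      _
        ≡⟨ ∑-cong V (λ x → ∑-cartesianProduct V V _) ⟩
      _
        ≡⟨ ∑³-cong V V V (λ x y z → trans
             (bit-∧ (does (x ∈? fibre i)) (does (y ∈? fibre j)) (does (z ∈? fibre l)) (edgeBit H x y z))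
             (cong₂ _*_ (∈?-fibre x i) (cong₂ _*_ (∈?-fibre y j) (cong (_* bit (edgeBit H x y z)) (∈?-fibre z l))))) ⟩
      ∑³ V V V (λ x y z → at i x * (at j y * (at l z * bit (edgeBit H x y z))))
        ≡⟨ ∑-cong V (λ x → trans
             (∑-cong V λ y → trans (∑-* (at i x) V _)
               (cong (at i x *_) (trans (∑-* (at j y) V _) (cong (at j y *_) (sym (∑-filter _ V _))))))
             (trans (∑-* (at i x) V _) (cong (at i x *_) (sym (∑-filter _ V _))))) ⟩
      ∑[ x ← V ] (at i x * (∑[ y ← block j ] ∑[ z ← block l ] bit (edgeBit H x y z)))
        ≡⟨ ∑-filter _ V _ ⟨
      box (λ x y z → bit (edgeBit H x y z)) i j l ∎
      where
      open ≡-Reasoning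
      V = allFin n
      at : Fin N → Fin n → ℕ
      at i x = bit (does (φ x Fin.≟ i))
      ∈?-fibre : ∀ x i → bit (does (x ∈? fibre i)) ≡ at i x
      ∈?-fibre x i = cong bit (does-⇔ (mk⇔ ∈-fibre⁻ ∈-fibre⁺) (x ∈? fibre i) (φ x Fin.≟ i))
      bit-∧ : ∀ a b c e → bit ((a ∧ b ∧ c) ∧ e) ≡ bit a * (bit b * (bit c * bit e))
      bit-∧ false b     c     e     = refl
      bit-∧ true  false c     e     = refl
      bit-∧ true  true  false e     = refl
      bit-∧ true  true  true  false = refl
      bit-∧ true  true  true  true  = refl

    volume≡ : ∀ i j l → ∣ fibre i ∣ * ∣ fibre j ∣ * ∣ fibre l ∣ ≡ volume i j l
    volume≡ i j l = cong₂ _*_ (cong₂ _*_ (∣fibre∣ i) (∣fibre∣ j)) (∣fibre∣ l)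

    mistakes-false : ∀ i j l → mistakes (edgeBit H) false i j l ≡ #edges H (fibre i) (fibre j) (fibre l)
    mistakes-false i j l = trans
      (∑³-cong (block i) (block j) (block l) λ x y z → cong bit (Bool.xor-identityʳ (edgeBit H x y z)))
      (sym (#edges≡box i j l))

    mistakes-true : ∀ i j l → mistakes (edgeBit H) true i j l + #edges H (fibre i) (fibre j) (fibre l) ≡ volume i j l
    mistakes-true i j l = begin
      mistakes (edgeBit H) true i j l + #edges H (fibre i) (fibre j) (fibre l)
        ≡⟨ cong (mistakes (edgeBit H) true i j l +_) (#edges≡box i j l) ⟩
      mistakes (edgeBit H) true i j l + box (λ x y z → bit (edgeBit H x y z)) i j l
        ≡⟨ ∑³-+ (block i) (block j) (block l) _ _ ⟨
      box (λ x y z → bit (edgeBit H x y z xor true) + bit (edgeBit H x y z)) i j l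
        ≡⟨ ∑³-cong (block i) (block j) (block l) (λ x y z → complementary (edgeBit H x y z)) ⟩
      box (λ _ _ _ → 1) i j l
        ≡⟨ trans (box-const i j l 1) (*-identityʳ (volume i j l)) ⟩
      volume i j l ∎
      where
      open ≡-Reasoning
      complementary : ∀ b → bit (b xor true) + bit b ≡ 1
      complementary false = refl
      complementary true  = refl

    module _ (onto : Surjective φ) where
      open Partition (fibres onto) using (nonempty)

      instance
        fibre-nonZero : ∀ {i} → NonZero ∣ fibre i ∣
        fibre-nonZero {i} = ∣∣-nonZero (nonempty i)

      -- For `c = false` the mistakes are the edges and bound the density; for `c = true` they are
      -- the non-edges and bound its complement. Either ratio is at most 1 / m, which is below `ε`.
      homogeneous : ∀ (ε : ℝ) m .{{_ : NonZero m}} → Below ε (unit m) → ∀ c i j l →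
        m * mistakes (edgeBit H) c i j l ≤ volume i j l →
        HomogeneousTriple ε H (nonempty i) (nonempty j) (nonempty l)
      homogeneous ε m 1/m<ε false i j l few = inj₁ (below-≤ ε (/-mono e vol 1 m (begin
        e * m                                 ≡⟨ *-comm e m ⟩
        m * e                                 ≡⟨ cong (m *_) (mistakes-false i j l) ⟨
        m * mistakes (edgeBit H) false i j l  ≤⟨ few ⟩
        volume i j l                          ≡⟨ volume≡ i j l ⟨
        vol                                   ≡⟨ *-identityˡ vol ⟨
        1 * vol                               ∎)) 1/m<ε)
        where
        open ≤-Reasoning
        e vol : ℕ
        e = #edges H (fibre i) (fibre j) (fibre l)
        vol = ∣ fibre i ∣ * ∣ fibre j ∣ * ∣ fibre l ∣
        instance
          _ : NonZero (∣ fibre i ∣ * ∣ fibre j ∣)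
          _ = m*n≢0 ∣ fibre i ∣ ∣ fibre j ∣
          _ : NonZero vol
          _ = m*n≢0 (∣ fibre i ∣ * ∣ fibre j ∣) ∣ fibre l ∣
      homogeneous ε m 1/m<ε true i j l few = inj₂ (below-≤ ε (1-d≤ (begin
        1 * (m * vol)                                 ≡⟨ *-identityˡ (m * vol) ⟩
        m * vol                                       ≡⟨ cong (m *_) (volume≡ i j l) ⟩
        m * volume i j l                              ≡⟨ cong (m *_) (mistakes-true i j l) ⟨
        m * (mistakes (edgeBit H) true i j l + e)     ≡⟨ *-distribˡ-+ m _ e ⟩
        m * mistakes (edgeBit H) true i j l + m * e   ≤⟨ +-monoˡ-≤ (m * e) few ⟩
        volume i j l + m * e                          ≡⟨ cong (_+ m * e) (volume≡ i j l) ⟨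
        vol + m * e                                   ≡⟨ regroup vol m e ⟩
        (1 * vol + e * m) * 1                         ∎)) 1/m<ε)
        where
        open ≤-Reasoning
        e vol : ℕ
        e = #edges H (fibre i) (fibre j) (fibre l)
        vol = ∣ fibre i ∣ * ∣ fibre j ∣ * ∣ fibre l ∣
        instance
          _ : NonZero (∣ fibre i ∣ * ∣ fibre j ∣)
          _ = m*n≢0 ∣ fibre i ∣ ∣ fibre j ∣
          _ : NonZero vol
          _ = m*n≢0 (∣ fibre i ∣ * ∣ fibre j ∣) ∣ fibre l ∣
        regroup : ∀ v m e → v + m * e ≡ (1 * v + e * m) * 1
        regroup = solve-∀
        d : ℚ
        d = density H (nonempty i) (nonempty j) (nonempty l)
        1-d≤ : 1 * (m * vol) ≤ (1 * vol + e * m) * 1 → 1ℚ ℚ.- d ℚ.≤ unit m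
        1-d≤ le = /-complement e vol m le

      homogeneousPartition : ∀ (ε : ℝ) m .{{_ : NonZero m}} → Below ε (unit m) → ∀ c →
        m * #bad (edgeBit H) m c ≤ n ^ 3 → HomogeneousPartition ε H (fibres onto)
      homogeneousPartition ε m 1/m<ε c few =
        T ,
        Unique.filter⁺ good? (Unique.cartesianProduct⁺ (Unique.allFin⁺ n)
          (Unique.cartesianProduct⁺ (Unique.allFin⁺ n) (Unique.allFin⁺ n))) ,
        All.map (λ {t} → good t) (all-filter good? triples) ,
        λ q ε<q → most-good n m (length T) (#bad (edgeBit H) m c) size few q (ℚ.<⇒≤ (below<above ε 1/m<ε ε<q))
        where
        V = allFin n
        triples : List (Triple n)
        triples = cartesianProduct V (cartesianProduct V V)
        bad : Triple n → Bool
        bad (x , y , z) = Bad (edgeBit H) m c (φ x) (φ y) (φ z)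
        -- Homogeneity with respect to `ε` is not decidable, so the filter tests `Bad`, and
        -- homogeneity of the survivors is derived afterwards.
        good? : ∀ t → Dec (bad t ≡ false)
        good? t = bad t Bool.≟ false
        T : List (Triple n)
        T = filter good? triples
        good : ∀ t → bad t ≡ false → _
        good (x , y , z) eq = φ x , φ y , φ z ,
          homogeneous ε m 1/m<ε (c (φ x) (φ y) (φ z)) (φ x) (φ y) (φ z)
            (≮⇒≥ (does≡false⇒
              (volume (φ x) (φ y) (φ z) <? m * mistakes (edgeBit H) (c (φ x) (φ y) (φ z)) (φ x) (φ y) (φ z)) eq)) ,
          ∈-fibre⁺ refl , ∈-fibre⁺ refl , ∈-fibre⁺ refl
        size : length T + #bad (edgeBit H) m c ≡ n ^ 3
        size = begin
          length T + #bad (edgeBit H) m c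
            ≡⟨ cong (_+ #bad (edgeBit H) m c) (trans (length-filter-∑ good? triples)
                 (trans (∑-cartesianProduct V (cartesianProduct V V) _) (∑-cong V λ x → ∑-cartesianProduct V V _))) ⟩
          ∑³ V V V (λ x y z → bit (does (good? (x , y , z)))) + #bad (edgeBit H) m c
            ≡⟨ ∑³-+ V V V _ _ ⟨
          ∑³ V V V (λ x y z → bit (does (good? (x , y , z))) + bit (bad (x , y , z)))
            ≡⟨ ∑³-cong V V V (λ x y z → complementary (bad (x , y , z))) ⟩
          ∑³ V V V (λ _ _ _ → 1)
            ≡⟨ ∑³-const V V V 1 ⟩
          length V * length V * length V * 1
            ≡⟨ cong (λ a → a * a * a * 1) (length-tabulate {n = n} id) ⟩
          n * n * n * 1
            ≡⟨ cube n ⟩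
          n ^ 3 ∎
          where
          open ≡-Reasoning
          complementary : ∀ b → bit (does (b Bool.≟ false)) + bit b ≡ 1
          complementary false = refl
          complementary true  = refl
          cube : ∀ n → n * n * n * 1 ≡ n * (n * (n * 1))
          cube = solve-∀

-- The number of parts as a function of ε

exponent : ℕ → ℕ
exponent k = (4 + k + (2 + 2)) * 3

-- In `exponent`, 4 pays for the factor 14, `k` for the factor `k`, each 2 for one factor `2 + t`,
-- and the final 3 for the cube.
scale^3-bound : ∀ k t → 2 ≤ t → scale k (2 + t) ^ 3 ≤ t ^ exponent k
scale^3-bound k t 2≤t = begin
  scale k (2 + t) ^ 3            ≤⟨ ^-monoˡ-≤ 3 (*-mono-≤ (*-mono-≤ 14≤ k≤) (*-mono-≤ m≤ m≤)) ⟩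
  (t ^ 4 * t ^ k * (t ^ 2 * t ^ 2)) ^ 3
                                 ≡⟨ cong (_^ 3) (cong₂ _*_ (^-distribˡ-+-* t 4 k) (^-distribˡ-+-* t 2 2)) ⟨
  (t ^ (4 + k) * t ^ (2 + 2)) ^ 3 ≡⟨ cong (_^ 3) (^-distribˡ-+-* t (4 + k) (2 + 2)) ⟨
  (t ^ (4 + k + (2 + 2))) ^ 3    ≡⟨ ^-*-assoc t (4 + k + (2 + 2)) 3 ⟩
  t ^ exponent k                 ∎
  where
  open ≤-Reasoning
  14≤ : 14 ≤ t ^ 4
  14≤ = ≤-trans (m≤m+n 14 2) (^-monoˡ-≤ 4 2≤t)
  k≤ : k ≤ t ^ k
  k≤ = ≤-trans (<⇒≤ (n<2^n k)) (^-monoˡ-≤ k 2≤t)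
  m≤ : 2 + t ≤ t ^ 2
  m≤ = begin
    2 + t     ≤⟨ +-monoˡ-≤ t 2≤t ⟩
    t + t     ≡⟨ cong (t +_) (+-identityʳ t) ⟨
    2 * t     ≤⟨ *-monoˡ-≤ t 2≤t ⟩
    t * t     ≡⟨ cong (t *_) (*-identityʳ t) ⟨
    t ^ 2     ∎

-- A bound 2 ^ (t ^ K) lies under the double exponential because t ^ K is below 2 ^ (t ^ K); the
-- cuts are then unfolded from the inside out.
≤ᵘ-doubleExponential : ∀ ε t K {S N} .{{_ : NonZero t}} →
  Above ε (unit t) → S ≤ t ^ K → N ≤ 2 ^ S → N ≤ᵘ 2^ 2^ ε ^- K
≤ᵘ-doubleExponential ε t K {S} {N} ε<1/t S≤ N≤ q q> = ℚ.≤-trans (fromℕ-mono (begin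
  N                ≤⟨ N≤ ⟩
  2 ^ S            ≤⟨ ^-monoʳ-≤ 2 S≤ ⟩
  2 ^ (t ^ K)      ≤⟨ ^-monoʳ-≤ 2 (<⇒≤ (n<2^n (t ^ K))) ⟩
  2 ^ 2 ^ (t ^ K)  ∎))
  (2^-lower (2 ^ (t ^ K)) (2^-lower (t ^ K) (^--lower ε t K ε<1/t)) q q>)
  where open ≤-Reasoning

theorem1p4 : ∀ (k : ℕ) → 1 ≤ k →
    Σ ℕ λ K → Σ ℝ λ ε* → 0 < K × 0ᵣ <ᵣ ε* ×
    (∀ (ε : ℝ) → 0ᵣ <ᵣ ε → ε <ᵣ ε* →
    Σ ℕ λ n₀ → ∀ (n : ℕ) → n₀ ≤ n →
    (H : 3-Graph n) (s : ℕ) → SVC H s → s < k →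
    Σ ℕ λ N → Σ (Partition n N) λ P →
    HomogeneousPartition ε H P × N ≤ᵘ 2^ 2^ ε ^- K)
theorem1p4 k 1≤k = exponent k , fromℚ (unit 4) , s≤s z≤n ,
  -- The rational 1 / 5 separates 0 from the threshold 1 / 4.
  (unit 5 , from-yes (0ℚ ℚ.<? unit 5) , from-yes (unit 5 ℚ.<? unit 4)) ,
  -- The threshold for `n` is 1, because sampling needs a vertex to choose. The bracket 1 / (2 + t)
  -- < ε < 1 / t with `t = 3 + j` supplies `m = 2 + t` for homogeneity and `t` for the number of
  -- parts.
  λ ε 0<ε ε<1/4 → let j , below , above = bracket ε 0<ε ε<1/4 in 1 , λ n 0<n H s svc s<k →
    main ε (3 + j) (s≤s (s≤s z≤n)) below above n 0<n H (λ y → SVC<⇒¬shatters H svc s<k y ∘ rowsShatter⇒shatters H y)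
  where
  main : ∀ ε t .{{_ : NonZero t}} → 2 ≤ t → Below ε (unit (2 + t)) → Above ε (unit t) →
    ∀ n → 0 < n → (H : 3-Graph n) →
    (∀ y → ¬ RowsShatter (λ x z → edgeBit H x y z) k) →
    Σ ℕ λ N → Σ (Partition n N) λ P → HomogeneousPartition ε H P × N ≤ᵘ 2^ 2^ ε ^- exponent k
  main ε t 2≤t below above n 0<n H ¬sh =
    let N , N-small , φ , onto , c , few = homogeneousBoxes k (2 + t) n {{>-nonZero 1≤k}} 0<n
          (edgeBit H) (edgeBit-swap₁₂ H) (edgeBit-swap₂₃ H) ¬sh
    in N , fibres φ onto , homogeneousPartition φ H onto ε (2 + t) below c few ,
       ≤ᵘ-doubleExponential ε t (exponent k) above (scale^3-bound k t 2≤t) N-small
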